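{- For every $n\geq1$ there exists a bijection $\Psi:\mathbf{I}_n(021)\to\mathfrak{S}_n(2413,4213)$ such that for every $e\in\mathbf{I}_n(021)$, with $\pi=\Psi(e)$, $$\mathrm{DIST}(e)=\mathrm{VID}(\pi),\quad \mathrm{ASC}(e)=\mathrm{DES}(\pi),\quad \mathrm{ZERO}(e)=\mathrm{LMA}(\pi),$$ $$\mathrm{EMA}(e)=\mathrm{LMI}(\pi),\quad \mathrm{RMI}(e)=\mathrm{RMA}(\pi),\quad \mathrm{EXPO}(e)=\mathrm{RMI}(\pi).$$
   Context: $\mathbf{I}_n=\{(e_1,\ldots,e_n): 0\leq e_i<i\}$; $\mathbf{I}_n(021)$ is the set of $e\in\mathbf{I}_n$ with no $i<j<k$ such that $e_i<e_k<e_j$. $\mathfrak{S}_n(2413,4213)$ is the set of permutations $\pi$ of $\{1,\ldots,n\}$ containing no subsequence $\pi_a\pi_b\pi_c\pi_d$ ($a<b<c<d$) order-isomorphic to $2413$ or to $4213$. Statistics on $\pi\in\mathfrak{S}_n$: $\mathrm{DES}(\pi)=\{i\in[n-1]:\pi_i>\pi_{i+1}\}$; $\mathrm{VID}(\pi)=\{2\leq i\leq n: \text{the value }\pi_i+1\text{ appears to the left of position } i \text{ in }\pi\}$; $\mathrm{LMA}(\pi)=\{i:\pi_i>\pi_j\ \forall j<i\}$; $\mathrm{LMI}(\pi)=\{i:\pi_i<\pi_j\ \forall j<i\}$; $\mathrm{RMA}(\pi)=\{i:\pi_i>\pi_j\ \forall j>i\}$; $\mathrm{RMI}(\pi)=\{i:\pi_i<\pi_j\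 \forall j>i\}$. Statistics on $e\in\mathbf{I}_n$: $\mathrm{ASC}(e)=\{i\in[n-1]:e_i<e_{i+1}\}$; $\mathrm{DIST}(e)=\{2\leq i\leq n: e_i\neq0 \text{ and } e_i\neq e_j \text{ for all } j>i\}$; $\mathrm{ZERO}(e)=\{i:e_i=0\}$; $\mathrm{EMA}(e)=\{i: e_i=i-1\}$; $\mathrm{RMI}(e)=\{i: e_i<e_j\ \forall j>i\}$. For $e\in\mathbf{I}_n(021)$ define $d_i=e_i$ if $e_i\neq0$ and $d_i=\max\{e_1,\ldots,e_i\}$ if $e_i=0$; let $\mathcal{C}(e)=\{i: e_i=0\text{ and there exist } a<i<b \text{ with } e_a=e_b\neq0\}$; and $\mathrm{EXPO}(e)=\{i\in[n]: i\notin\mathcal{C}(e)\text{ and } i-d_i<j-d_j \text{ for all } j>i\}$. -}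

module Defs where

open import Data.Nat using (ℕ; zero; suc; _≤_; _<_; _∸_; _⊔_)
open import Data.Fin using (Fin; toℕ) renaming (_<_ to _<ᶠ_)
open import Data.Vec using (Vec; lookup; _∷_; [])
open import Data.Product using (_×_; ∃; ∃-syntax)
open import Relation.Nullary using (¬_)
open import Relation.Binary.PropositionalEquality using (_≡_; _≢_)
open import Level using (0ℓ)
open import Relation.Unary using (Pred)

-- Conventions: a word w₁…wₙ is a  Vec ℕ n ; the entry at index i : Fin n is
-- the entry at (1-based) position  toℕ i + 1 .  Sets of positions are
-- predicates on Fin n (index i ↔ position toℕ i + 1).

Stat : ℕ → Set₁
Stat n = Pred (Fin n) 0ℓ

IsInversionSeq : ∀ {n} → Vec ℕ n → Set
IsInversionSeq {n} e = ∀ (i : Fin n) → lookup e i < suc (toℕ i)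

Avoids021 : ∀ {n} → Vec ℕ n → Set
Avoids021 {n} e = ∀ (i j k : Fin n) → i <ᶠ j → j <ᶠ k →
  ¬ (lookup e i < lookup e k × lookup e k < lookup e j)

InI021 : ∀ {n} → Vec ℕ n → Set
InI021 e = IsInversionSeq e × Avoids021 e

IsPermutation : ∀ {n} → Vec ℕ n → Set
IsPermutation {n} π =
  (∀ (i : Fin n) → 1 ≤ lookup π i × lookup π i ≤ n) ×
  (∀ (i j : Fin n) → lookup π i ≡ lookup π j → i ≡ j)

Contains2413 : ∀ {n} → Vec ℕ n → Set
Contains2413 {n} π = ∃[ a ] ∃[ b ] ∃[ c ] ∃[ d ]
  (a <ᶠ b × b <ᶠ c × c <ᶠ d ×
   lookup π c < lookup π a × lookup π a < lookup π d × lookup π d < lookup π b)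

Contains4213 : ∀ {n} → Vec ℕ n → Set
Contains4213 {n} π = ∃[ a ] ∃[ b ] ∃[ c ] ∃[ d ]
  (a <ᶠ b × b <ᶠ c × c <ᶠ d ×
   lookup π c < lookup π b × lookup π b < lookup π d × lookup π d < lookup π a)

InS2413-4213 : ∀ {n} → Vec ℕ n → Set
InS2413-4213 π = IsPermutation π × ¬ Contains2413 π × ¬ Contains4213 π

DES : ∀ {n} → Vec ℕ n → Stat n
DES {n} π i = ∃[ j ] (toℕ j ≡ suc (toℕ i) × lookup π j < lookup π i)

VID : ∀ {n} → Vec ℕ n → Stat n
VID {n} π i = 1 ≤ toℕ i × ∃[ j ] (j <ᶠ i × lookup π j ≡ suc (lookup π i))

LMA : ∀ {n} → Vec ℕ n → Stat n
LMA {n} π i = ∀ (j : Fin n) → j <ᶠ i → lookup π j < lookup π i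

LMI : ∀ {n} → Vec ℕ n → Stat n
LMI {n} π i = ∀ (j : Fin n) → j <ᶠ i → lookup π i < lookup π j

RMA : ∀ {n} → Vec ℕ n → Stat n
RMA {n} π i = ∀ (j : Fin n) → i <ᶠ j → lookup π j < lookup π i

RMIπ : ∀ {n} → Vec ℕ n → Stat n
RMIπ {n} π i = ∀ (j : Fin n) → i <ᶠ j → lookup π i < lookup π j

ASC : ∀ {n} → Vec ℕ n → Stat n
ASC {n} e i = ∃[ j ] (toℕ j ≡ suc (toℕ i) × lookup e i < lookup e j)

DIST : ∀ {n} → Vec ℕ n → Stat n
DIST {n} e i = 1 ≤ toℕ i × lookup e i ≢ 0 ×
  (∀ (j : Fin n) → i <ᶠ j → lookup e i ≢ lookup e j)

ZERO : ∀ {n} → Vec ℕ n → Stat n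
ZERO e i = lookup e i ≡ 0

EMA : ∀ {n} → Vec ℕ n → Stat n
EMA e i = lookup e i ≡ toℕ i

RMIe : ∀ {n} → Vec ℕ n → Stat n
RMIe {n} e i = ∀ (j : Fin n) → i <ᶠ j → lookup e i < lookup e j

maxPrefix : ∀ {n} → Vec ℕ n → Fin n → ℕ
maxPrefix (x ∷ xs) Fin.zero    = x
maxPrefix (x ∷ xs) (Fin.suc i) = x ⊔ maxPrefix xs i

dval : ∀ {n} → Vec ℕ n → Fin n → ℕ
dval e i with lookup e i
... | zero  = maxPrefix e i
... | suc m = suc m

Cset : ∀ {n} → Vec ℕ n → Stat n
Cset {n} e i = lookup e i ≡ 0 × ∃[ a ] ∃[ b ]
  (a <ᶠ i × i <ᶠ b × lookup e a ≡ lookup e b × lookup e a ≢ 0)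

-- EXPO(e) = {i ∉ 𝒞(e) : i - d_i < j - d_j for all j > i}   (positions 1-based;
-- on inversion sequences d_i ≤ i - 1, so truncated subtraction is exact)
EXPO : ∀ {n} → Vec ℕ n → Stat n
EXPO {n} e i = ¬ Cset e i ×
  (∀ (j : Fin n) → i <ᶠ j →
     suc (toℕ i) ∸ dval e i < suc (toℕ j) ∸ dval e j)

{-# OPTIONS --safe #-}
module Submission where

-- Both classes are encoded by words in letters Z and N: Z marks a zero of e, respectively a
-- left-to-right maximum of π, and every letter carries a level. For e the level of a nonzero entry
-- e_i is i + 1 − e_i. For π it is one more than the number, counted from below, of the place where
-- the value is inserted among the places that do not complete a 2413 or a 4213 (the place above all
-- values is not counted): inserting v closes all places above v except the one just above v and the
-- one on top, so the admissible words are the same for e and for π. Under these two encodings ASC,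
-- ZERO and EMA correspond to DES, LMA and LMI, but DIST and EXPO do not correspond to VID and RMI.
-- This is repaired by shifting levels. Call the segment of a nonzero letter d of level k the letters
-- after d up to the next nonzero letter of level ≤ k, and let z zeros follow d. In e the value of d
-- is repeated iff its segment begins, after these zeros, at the greatest possible level k + z + 1; in
-- π the value just above that of d occurs to its right iff the least level k + 1 occurs somewhere in
-- the segment. So a segment beginning at level k + z + 1 is lowered until its minimum is k + 1, and
-- any other one is raised by 1. Segments are nested or disjoint, and a shift does not change the
-- comparisons inside a segment, so these moves are compatible and invertible.
-- RMI(e) and RMA(π) are determined by ZERO(e) and ASC(e), respectively LMA(π) and DES(π).

open import Defs
open import Data.Bool using (Bool; true; false; if_then_else_)
open import Data.Empty using (⊥; ⊥-elim)
open import Data.Fin using (Fin; zero; suc; toℕ; fromℕ<; punchOut) renaming (_<_ to _<ᶠ_)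
open import Data.Fin.Properties using (any?; all?; toℕ<n; toℕ-injective; toℕ-fromℕ<; punchOut-injective; injective⇒≤)
  renaming (<-cmp to <ᶠ-cmp; _<?_ to _<ᶠ?_)
open import Data.Fin.Subset using (Subset; inside; outside; _∈_; _∉_; _⊆_; ∣_∣)
open import Data.Fin.Subset.Properties using (p⊆q⇒∣p∣≤∣q∣; ∣p∣≤n; drop-there; out⊆; ⊆-antisym)
open import Data.Nat
open import Data.Nat.Properties
open import Data.Product using (_×_; _,_; proj₁; proj₂; ∃-syntax; Σ-syntax)
open import Data.Sum using (_⊎_; inj₁; inj₂)
open import Data.Unit using (⊤; tt)
open import Data.Vec using (Vec; []; _∷_; lookup; map; here; there)
open import Data.Vec.Properties using (lookup-map; ∷-injectiveˡ; ∷-injectiveʳ)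
open import Function using (_∘_; _⇔_; mk⇔; Equivalence)
open import Relation.Binary.Definitions using (tri<; tri≈; tri>)
open import Relation.Binary.PropositionalEquality
open import Relation.Nullary
open import Relation.Unary using (_≐_)
open Equivalence using (to; from)

private variable
  n h k m p r β γ : ℕ

-- Words with levels, and the later values below a place.

data Letter : Set where
  Z N : ℕ → Letter

Word : ℕ → Set
Word = Vec Letter

-- The index is the level reached so far, i.e. the number of places (other than the top) open to the
-- next value of π.
data Valid : ∀ {n} → ℕ → Word n → Set where
  []  : Valid h []
  zer : {w : Word n} → Valid (suc h) w → Valid h (Z (suc h) ∷ w)
  nz  : {w : Word n} → 2 ≤ k → k ≤ suc h → Valid k w → Valid h (N k ∷ w)

-- The highest open place below the value of the letter, just after its insertion.
base : Letter → ℕ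
base (Z h) = h
base (N k) = pred k

-- The later positions whose values lie below an element, if  β  is the highest place below it: a
-- value inserted at a place ≤ β goes below the element and leaves one more place there.
below : ℕ → Word n → Subset n
below β [] = []
below β (Z _ ∷ w) = outside ∷ below β w
below β (N k ∷ w) with k ≤? suc β
... | yes _ = inside ∷ below k w
... | no _  = outside ∷ below β w

below-in : {w : Word n} → k ≤ suc β → below β (N k ∷ w) ≡ inside ∷ below k w
below-in {k = k} {β} k≤ with k ≤? suc β
... | yes _ = refl
... | no k≰ = contradiction k≤ k≰

below-out : {w : Word n} → suc β < k → below β (N k ∷ w) ≡ outside ∷ below β w
below-out {β = β} {k} <k with k ≤? suc β
... | yes k≤ = contradiction k≤ (<⇒≱ <k)
... | no _ = refl

below-mono : (w : Word n) → β ≤ γ → below β w ⊆ below γ w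
below-mono [] _ ()
below-mono (Z _ ∷ w) β≤γ = out⊆ (below-mono w β≤γ)
below-mono {β = β} {γ} (N k ∷ w) β≤γ with k ≤? suc β | k ≤? suc γ
... | yes _  | yes _  = λ x → x
... | yes k≤ | no k≰  = contradiction (≤-trans k≤ (s≤s β≤γ)) k≰
... | no k≰  | yes _  = out⊆ (below-mono w (≤-trans (n≤1+n β) (<⇒≤ (≰⇒> k≰))))
... | no _   | no _   = out⊆ (below-mono w β≤γ)

-- The permutation of a word.

bump : ℕ → ℕ → ℕ
bump r v with v ≤? r
... | yes _ = v
... | no _  = suc v

bump-≤ : ∀ {v} → v ≤ r → bump r v ≡ v
bump-≤ {r} {v} v≤r with v ≤? r
... | yes _ = refl
... | no v≰r = contradiction v≤r v≰r

v≤bump : ∀ r v → v ≤ bump r v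
v≤bump r v with v ≤? r
... | yes _ = ≤-refl
... | no _ = n≤1+n v

bump≤suc : ∀ r v → bump r v ≤ suc v
bump≤suc r v with v ≤? r
... | yes _ = n≤1+n v
... | no _ = ≤-refl

bump-mono-< : ∀ r {u v} → u < v → bump r u < bump r v
bump-mono-< r {u} {v} u<v with u ≤? r | v ≤? r
... | yes _ | yes _ = u<v
... | yes _ | no _  = m≤n⇒m≤1+n u<v
... | no u≰ | yes v≤ = contradiction (≤-trans (<⇒≤ u<v) v≤) u≰
... | no _  | no _  = s≤s u<v

bump-cancel-< : ∀ r {u v} → bump r u < bump r v → u < v
bump-cancel-< r {u} {v} lt with <-cmp u v
... | tri< u<v _ _ = u<v
... | tri≈ _ refl _ = contradiction lt (<-irrefl refl)
... | tri> _ _ v<u = contradiction (bump-mono-< r v<u) (<-asym lt)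

bump-injective : ∀ r {u v} → bump r u ≡ bump r v → u ≡ v
bump-injective r {u} {v} eq with <-cmp u v
... | tri< u<v _ _ = contradiction eq (<⇒≢ (bump-mono-< r u<v))
... | tri≈ _ u≡v _ = u≡v
... | tri> _ _ v<u = contradiction (sym eq) (<⇒≢ (bump-mono-< r v<u))

bump≢ : ∀ r v → bump r v ≢ suc r
bump≢ r v eq with v ≤? r
... | yes v≤r = <⇒≢ (s≤s v≤r) eq
... | no v≰r = v≰r (≤-reflexive (suc-injective eq))

#below : ℕ → Word n → ℕ
#below β w = ∣ below β w ∣

-- Although the letters describe insertions from left to right, the permutation is assembled from
-- the right: the number of later values below the head fixes its value relative to the tail, and
-- `bump` makes room for it.
perm : Word n → Vec ℕ n
perm [] = []
perm (x ∷ w) = suc (#below (base x) w) ∷ map (bump (#below (base x) w)) (perm w)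

perm-isPermutation : (w : Word n) → IsPermutation (perm w)
perm-isPermutation w = bounds w , injective w
  where
  bounds : (w : Word n) (i : Fin n) → 1 ≤ lookup (perm w) i × lookup (perm w) i ≤ n
  bounds (x ∷ w) zero = s≤s z≤n , s≤s (∣p∣≤n (below (base x) w))
  bounds (x ∷ w) (suc i)
    rewrite lookup-map i (bump (#below (base x) w)) (perm w) =
      ≤-trans (proj₁ (bounds w i)) (v≤bump _ _) ,
      ≤-trans (bump≤suc _ _) (s≤s (proj₂ (bounds w i)))

  injective : (w : Word n) (i j : Fin n) → lookup (perm w) i ≡ lookup (perm w) j → i ≡ j
  injective (x ∷ w) zero zero _ = refl
  injective (x ∷ w) zero (suc j) eq
    rewrite lookup-map j (bump (#below (base x) w)) (perm w) = contradiction (sym eq) (bump≢ _ (lookup (perm w) j))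
  injective (x ∷ w) (suc i) zero eq
    rewrite lookup-map i (bump (#below (base x) w)) (perm w) = contradiction eq (bump≢ _ (lookup (perm w) i))
  injective (x ∷ w) (suc i) (suc j) eq
    rewrite lookup-map i (bump (#below (base x) w)) (perm w)
          | lookup-map j (bump (#below (base x) w)) (perm w) =
      cong suc (injective w i j (bump-injective _ eq))

-- The sets  below β w , β ≤ h , form a chain of initial segments for the order of the values.
below⇔≤ : {w : Word n} → Valid h w → β ≤ h → (j : Fin n) →
          j ∈ below β w ⇔ lookup (perm w) j ≤ (#below β w)
below⇔≤ {h = h} {β} {w = Z _ ∷ w} (zer v) β≤h zero =
  mk⇔ (λ ()) λ le → contradiction le (<⇒≱ (s≤s (p⊆q⇒∣p∣≤∣q∣ (below-mono w (m≤n⇒m≤1+n β≤h)))))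
below⇔≤ {h = h} {β} {w = Z _ ∷ w} (zer v) β≤h (suc j)
  rewrite lookup-map j (bump (#below (suc h) w)) (perm w) =
  mk⇔ (λ { (there m) → let le = to (below⇔≤ v (m≤n⇒m≤1+n β≤h) j) m in
              subst (_≤ _) (sym (bump-≤ (≤-trans le s≤r))) le })
      (λ le → there (from (below⇔≤ v (m≤n⇒m≤1+n β≤h) j) (≤-trans (v≤bump _ _) le)))
  where s≤r = p⊆q⇒∣p∣≤∣q∣ (below-mono w (m≤n⇒m≤1+n β≤h))
below⇔≤ {h = h} {β} {w = N k ∷ w} (nz 2≤k k≤ v) β≤h j with k ≤? suc β
below⇔≤ {h = h} {β} {w = N k ∷ w} (nz 2≤k k≤ v) β≤h zero | yes _ =
  mk⇔ (λ _ → s≤s (p⊆q⇒∣p∣≤∣q∣ (below-mono w pred[n]≤n))) (λ _ → here)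
below⇔≤ {h = h} {β} {w = N k ∷ w} (nz 2≤k k≤ v) β≤h (suc j) | yes _
  rewrite lookup-map j (bump (#below (pred k) w)) (perm w) =
  mk⇔ (λ { (there m) → ≤-trans (bump≤suc _ _) (s≤s (to (below⇔≤ v ≤-refl j) m)) })
      (λ le → there (from (below⇔≤ v ≤-refl j) (lemma le)))
  where
  -- The `suc` counts the head; a value above the head has been raised by one as well, so the two
  -- cancel.
  lemma : ∀ {u} → bump (#below (pred k) w) u ≤ suc (#below k w) → u ≤ (#below k w)
  lemma {u} le with u ≤? (#below (pred k) w)
  ... | yes u≤ = ≤-trans u≤ (p⊆q⇒∣p∣≤∣q∣ (below-mono w pred[n]≤n))
  ... | no _ = s≤s⁻¹ le
below⇔≤ {h = h} {β} {w = N k ∷ w} (nz 2≤k k≤ v) β≤h j | no k≰ = go j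
  where
  β<k : suc β < k
  β<k = ≰⇒> k≰
  s≤r = p⊆q⇒∣p∣≤∣q∣ (below-mono w (<⇒≤pred {m = β} (<-trans (n<1+n β) β<k)))
  go : ∀ j → j ∈ outside ∷ below β w ⇔ lookup (perm (N k ∷ w)) j ≤ (#below β w)
  go zero = mk⇔ (λ ()) (λ le → contradiction le (<⇒≱ (s≤s s≤r)))
  go (suc j) rewrite lookup-map j (bump (#below (pred k) w)) (perm w) =
    mk⇔ (λ { (there m) → let le = to (below⇔≤ v (<⇒≤ (<-trans (n<1+n β) β<k)) j) m in
              subst (_≤ _) (sym (bump-≤ (≤-trans le s≤r))) le })
      (λ le → there (from (below⇔≤ v (<⇒≤ (<-trans (n<1+n β) β<k)) j) (≤-trans (v≤bump _ _) le)))

base≤ : ∀ {x} {w : Word n} → Valid h (x ∷ w) → ∃[ g ] (Valid g w × base x ≤ g × 1 ≤ base x)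
base≤ (zer v) = _ , v , ≤-refl , s≤s z≤n
base≤ (nz (s≤s 1≤k) _ v) = _ , v , pred[n]≤n , 1≤k

-- Inversions and pattern avoidance.

Inv : Word n → Fin n → Fin n → Set
Inv (x ∷ w) zero (suc j) = j ∈ below (base x) w
Inv (x ∷ w) (suc i) (suc j) = Inv w i j
Inv (x ∷ w) _ zero = ⊥

perm-inv : {w : Word n} → Valid h w → (i j : Fin n) → i <ᶠ j →
           lookup (perm w) j < lookup (perm w) i ⇔ Inv w i j
perm-inv {w = x ∷ w} V zero (suc j) _ with base≤ V
... | g , v , b≤g , _ rewrite lookup-map j (bump (#below (base x) w)) (perm w) =
  mk⇔ (λ lt → from (below⇔≤ v b≤g j) (≤-trans (v≤bump _ _) (s≤s⁻¹ lt)))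
      (λ m → s≤s (subst (_≤ _) (sym (bump-≤ (to (below⇔≤ v b≤g j) m))) (to (below⇔≤ v b≤g j) m)))
perm-inv {w = x ∷ w} V (suc i) (suc j) (s≤s i<j) with base≤ V
... | g , v , _
  rewrite lookup-map i (bump (#below (base x) w)) (perm w)
        | lookup-map j (bump (#below (base x) w)) (perm w) =
  mk⇔ (to (perm-inv v i j i<j) ∘ bump-cancel-< _) (bump-mono-< _ ∘ from (perm-inv v i j i<j))

-- Once c is a member of a set  below β w , the later members no longer depend on β.
After : Word n → Fin n → Fin n → Set
After (x ∷ w) _ zero = ⊥
After (x ∷ w) (suc c) (suc d) = After w c d
After (Z _ ∷ w) zero (suc d) = ⊥
After (N k ∷ w) zero (suc d) = d ∈ below k w

below⇔After : (w : Word n) {c d : Fin n} → c ∈ below β w → c <ᶠ d → d ∈ below β w ⇔ After w c d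
below⇔After (Z _ ∷ w) {suc c} {suc d} (there m) (s≤s c<d) =
  mk⇔ (to (below⇔After w m c<d) ∘ drop-there) (there ∘ from (below⇔After w m c<d))
below⇔After {β = β} (N k ∷ w) m c<d with k ≤? suc β
below⇔After (N k ∷ w) {zero} {suc d} here c<d | yes _ = mk⇔ drop-there there
below⇔After (N k ∷ w) {suc c} {suc d} (there m) (s≤s c<d) | yes _ =
  mk⇔ (to (below⇔After w m c<d) ∘ drop-there) (there ∘ from (below⇔After w m c<d))
below⇔After (N k ∷ w) {suc c} {suc d} (there m) (s≤s c<d) | no _ =
  mk⇔ (to (below⇔After w m c<d) ∘ drop-there) (there ∘ from (below⇔After w m c<d))

-- Hence all elements exceeding the value at `c` from its left compare alike with each value after
-- `c`.
inv⇔After : (w : Word n) {a c d : Fin n} → a <ᶠ c → c <ᶠ d → Inv w a c → Inv w a d ⇔ After w c d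
inv⇔After (x ∷ w) {zero} {suc c} {suc d} a<c (s≤s c<d) m = below⇔After w m c<d
inv⇔After (x ∷ w) {suc a} {suc c} {suc d} (s≤s a<c) (s≤s c<d) m = inv⇔After w a<c c<d m

-- In both patterns two entries, in either order, precede and exceed the entry at `c`, and a later
-- value separates them; `inv⇔After` forbids such a separation.
perm-avoids : {w : Word n} → Valid h w → InS2413-4213 (perm w)
perm-avoids {w = w} V = perm-isPermutation w ,
  (λ (a , b , c , d , a<b , b<c , c<d , c<πa , a<πd , d<πb) →
     absurd a b c d (<-trans a<b b<c) b<c c<d c<πa a<πd d<πb) ,
  (λ (a , b , c , d , a<b , b<c , c<d , c<πb , b<πd , d<πa) →
     absurd b a c d b<c (<-trans a<b b<c) c<d c<πb b<πd d<πa)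
  where
  absurd : ∀ a b c d → a <ᶠ c → b <ᶠ c → c <ᶠ d →
           lookup (perm w) c < lookup (perm w) a → lookup (perm w) a < lookup (perm w) d →
           lookup (perm w) d < lookup (perm w) b → ⊥
  absurd a b c d a<c b<c c<d c<πa a<πd d<πb = <-asym a<πd
    (from (perm-inv V a d (<-trans a<c c<d))
      (from (inv⇔After w a<c c<d (to (perm-inv V a c a<c) c<πa))
        (to (inv⇔After w b<c c<d (to (perm-inv V b c b<c) (<-trans c<πa (<-trans a<πd d<πb))))
          (to (perm-inv V b d (<-trans b<c c<d)) d<πb))))

-- Permutations and their inversions.

-- Pigeonhole: punching out a missed value would inject `Fin (suc m)` into `Fin m`.
permutation-onto : (π : Vec ℕ n) → IsPermutation π → ∀ {v} → 1 ≤ v → v ≤ n → ∃[ j ] lookup π j ≡ v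
permutation-onto {n = suc m} π (bnd , inj) {suc u} _ (s≤s u≤m) with any? (λ j → lookup π j ≟ suc u)
... | yes hit = hit
... | no miss = contradiction (injective⇒≤ {f = f} f-injective) 1+n≰n
  where
  g< : ∀ i → pred (lookup π i) < suc m
  g< i with lookup π i | bnd i
  ... | suc _ | _ , le = le
  g : Fin (suc m) → Fin (suc m)
  g i = fromℕ< (g< i)
  g-val : ∀ i → suc (toℕ (g i)) ≡ lookup π i
  g-val i = trans (cong suc (toℕ-fromℕ< (g< i))) (suc-pred (lookup π i) ⦃ >-nonZero (proj₁ (bnd i)) ⦄)
  avoid : ∀ i → fromℕ< (s≤s u≤m) ≢ g i
  avoid i eq = miss (i , trans (sym (g-val i)) (cong suc (trans (cong toℕ (sym eq)) (toℕ-fromℕ< (s≤s u≤m)))))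
  f : Fin (suc m) → Fin m
  f i = punchOut (avoid i)
  f-injective : ∀ {i j} → f i ≡ f j → i ≡ j
  f-injective {i} {j} eq = inj i j (trans (sym (g-val i))
    (trans (cong (suc ∘ toℕ) (punchOut-injective (avoid i) (avoid j) eq)) (g-val j)))

-- Induction along the values: the position holding the preceding value of `π` already has a large
-- enough value in `ρ`, and that of `i` is strictly larger.
order-≤ : (π ρ : Vec ℕ n) → IsPermutation π → IsPermutation ρ →
          (∀ i j → lookup π i < lookup π j → lookup ρ i < lookup ρ j) →
          ∀ v i → lookup π i ≡ v → v ≤ lookup ρ i
order-≤ π ρ P R mono zero i eq = z≤n
order-≤ π ρ P R mono (suc zero) i eq = proj₁ (proj₁ R i)
order-≤ π ρ P R mono (suc v@(suc _)) i eq =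
  let j , eqj = permutation-onto π P {v} (s≤s z≤n)
                  (≤-trans (n≤1+n v) (subst (_≤ _) eq (proj₂ (proj₁ P i))))
  in ≤-trans (s≤s (order-≤ π ρ P R mono v j eqj)) (mono j i (subst₂ _<_ (sym eqj) (sym eq) ≤-refl))

lookup-ext : ∀ {A : Set} {xs ys : Vec A n} → (∀ i → lookup xs i ≡ lookup ys i) → xs ≡ ys
lookup-ext {xs = []} {[]} _ = refl
lookup-ext {xs = x ∷ xs} {y ∷ ys} eq = cong₂ _∷_ (eq zero) (lookup-ext (eq ∘ suc))

inversions-mono : (π ρ : Vec ℕ n) → IsPermutation ρ →
                  (∀ i j → i <ᶠ j → lookup π j < lookup π i ⇔ lookup ρ j < lookup ρ i) →
                  ∀ i j → lookup π i < lookup π j → lookup ρ i < lookup ρ j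
inversions-mono π ρ R inv i j lt with <ᶠ-cmp i j
... | tri≈ _ refl _ = contradiction lt (<-irrefl refl)
... | tri> _ _ j<i = to (inv j i j<i) lt
... | tri< i<j _ _ with <-cmp (lookup ρ i) (lookup ρ j)
...   | tri< lt′ _ _ = lt′
...   | tri≈ _ eq _ = contradiction (cong (lookup π) (proj₂ R i j eq)) (<⇒≢ lt)
...   | tri> _ _ gt = contradiction (from (inv i j i<j) gt) (<-asym lt)

inversions-determine : (π ρ : Vec ℕ n) → IsPermutation π → IsPermutation ρ →
                       (∀ i j → i <ᶠ j → lookup π j < lookup π i ⇔ lookup ρ j < lookup ρ i) → π ≡ ρ
inversions-determine π ρ P R inv = lookup-ext λ i → ≤-antisym
  (order-≤ π ρ P R (inversions-mono π ρ R inv) _ i refl)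
  (order-≤ ρ π R P (inversions-mono ρ π P λ i j i<j → mk⇔ (from (inv i j i<j)) (to (inv i j i<j))) _ i refl)

-- Injectivity: recovering a word from inversions.

∈below-head : {w : Word n} → zero ∈ below β (N k ∷ w) → k ≤ suc β
∈below-head {β = β} {k} m with k ≤? suc β
... | yes k≤ = k≤

head∈below : {w : Word n} → k ≤ suc β → zero ∈ below β (N k ∷ w)
head∈below {w = w} k≤ rewrite below-in {w = w} k≤ = here

∈below-in : {w : Word n} {j : Fin n} → k ≤ suc β → suc j ∈ below β (N k ∷ w) ⇔ j ∈ below k w
∈below-in {w = w} k≤ rewrite below-in {w = w} k≤ = mk⇔ drop-there there

∈below-out : {w : Word n} {j : Fin n} → suc β < k → suc j ∈ below β (N k ∷ w) ⇔ j ∈ below β w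
∈below-out {w = w} <k rewrite below-out {w = w} <k = mk⇔ drop-there there

Inv⇒< : (w : Word n) {i j : Fin n} → Inv w i j → i <ᶠ j
Inv⇒< (x ∷ w) {zero} {suc j} _ = s≤s z≤n
Inv⇒< (x ∷ w) {suc i} {suc j} m = s≤s (Inv⇒< w m)

-- A leading letter enters `below β` exactly from `β = level - 1` on; if `l` exceeded `k`, then
-- `β = l - 2` would tell the two words apart.
levels-≤ : ∀ {k l} {w u : Word n} → 2 ≤ k → l ≤ suc h →
           (∀ β → 1 ≤ β → β ≤ h → zero ∈ below β (N k ∷ w) → zero ∈ below β (N l ∷ u)) → l ≤ k
levels-≤ {k = k} {l} 2≤k l≤ f with l ≤? k
... | yes l≤k = l≤k
levels-≤ {k = k} {zero} 2≤k l≤ f | no l≰k = contradiction z≤n l≰k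
levels-≤ {k = k} {suc zero} 2≤k l≤ f | no l≰k = contradiction (<⇒≤ 2≤k) l≰k
levels-≤ {k = k} {suc (suc b)} 2≤k l≤ f | no l≰k =
  contradiction (∈below-head (f b (s≤s⁻¹ (≤-trans 2≤k k≤)) (≤-trans (n≤1+n b) (s≤s⁻¹ l≤)) (head∈below k≤))) 1+n≰n
  where k≤ = s≤s⁻¹ (≰⇒> l≰k)

-- The sets `below β` of the places open at the start are part of the hypothesis because, after the
-- first letter, such places stem from earlier elements, which the inversions of the tail do not
-- see.
words-determined : {w u : Word n} → Valid h w → Valid h u →
  (∀ β → 1 ≤ β → β ≤ h → ∀ j → j ∈ below β w ⇔ j ∈ below β u) →
  (∀ i j → Inv w i j ⇔ Inv u i j) → w ≡ u
words-determined [] [] _ _ = refl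
words-determined {h = h} (zer v) (zer v′) out inn =
  cong (_ ∷_) (words-determined v v′ out′ (λ i j → inn (suc i) (suc j)))
  where
  out′ : ∀ β → 1 ≤ β → β ≤ suc h → ∀ j → _
  out′ β 1≤β β≤ j with m≤n⇒m<n∨m≡n β≤
  ... | inj₁ β<sh = mk⇔ (drop-there ∘ to (out β 1≤β (s≤s⁻¹ β<sh) (suc j)) ∘ there)
                        (drop-there ∘ from (out β 1≤β (s≤s⁻¹ β<sh) (suc j)) ∘ there)
  ... | inj₂ refl = inn zero (suc j)
words-determined (zer v) (nz {k = suc k} (s≤s 1≤k) k≤ v′) out inn
  with from (out _ (≤-trans 1≤k (s≤s⁻¹ k≤)) ≤-refl zero) (head∈below k≤)
... | ()
words-determined (nz {k = suc k} (s≤s 1≤k) k≤ v) (zer v′) out inn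
  with to (out _ (≤-trans 1≤k (s≤s⁻¹ k≤)) ≤-refl zero) (head∈below k≤)
... | ()
words-determined {h = h} {w = N k ∷ w} {u = N l ∷ u} (nz 2≤k k≤ v) (nz 2≤l l≤ v′) out inn
  with ≤-antisym (levels-≤ 2≤l k≤ (λ β 1≤β β≤ → from (out β 1≤β β≤ zero)))
                 (levels-≤ 2≤k l≤ (λ β 1≤β β≤ → to (out β 1≤β β≤ zero)))
... | refl = cong (_ ∷_) (words-determined v v′ out′ (λ i j → inn (suc i) (suc j)))
  where
  1≤k-1 = s≤s⁻¹ (subst (2 ≤_) (sym (suc-pred k ⦃ >-nonZero (<⇒≤ 2≤k) ⦄)) 2≤k)
  k≤1+ : k ≤ suc (pred k)
  k≤1+ = ≤-reflexive (sym (suc-pred k ⦃ >-nonZero (<⇒≤ 2≤k) ⦄))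
  pk≤h : pred k ≤ h
  pk≤h = pred-mono-≤ k≤
  -- Place `k` of the tail is the old place `pred k`, its place `pred k` is new and governed by the
  -- inversions of the head, and lower places are unchanged.
  out′ : ∀ β → 1 ≤ β → β ≤ k → ∀ j → j ∈ below β w ⇔ j ∈ below β u
  out′ β 1≤β β≤ j with m≤n⇒m<n∨m≡n β≤
  ... | inj₂ refl = mk⇔ (to (∈below-in k≤1+) ∘ to (out _ 1≤k-1 pk≤h (suc j)) ∘ from (∈below-in k≤1+))
                        (to (∈below-in k≤1+) ∘ from (out _ 1≤k-1 pk≤h (suc j)) ∘ from (∈below-in k≤1+))
  ... | inj₁ β<k with m≤n⇒m<n∨m≡n β<k
  ...   | inj₂ refl = inn zero (suc j)
  ...   | inj₁ sβ<k = mk⇔ (to (∈below-out sβ<k) ∘ to (out β 1≤β β≤h (suc j)) ∘ from (∈below-out sβ<k))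
                          (to (∈below-out sβ<k) ∘ from (out β 1≤β β≤h (suc j)) ∘ from (∈below-out sβ<k))
          where β≤h = ≤-trans (<⇒≤pred β<k) pk≤h

perm-injective : {w u : Word n} → Valid 0 w → Valid 0 u → perm w ≡ perm u → w ≡ u
-- At level 0 no place is open yet, so only the inversions have to agree.
perm-injective {w = w} {u} V U eq = words-determined V U (λ _ 1≤β β≤0 → contradiction (≤-trans 1≤β β≤0) λ ())
  λ i j → mk⇔ (λ m → let i<j = Inv⇒< w m in
                 to (perm-inv U i j i<j) (subst (λ π → lookup π j < lookup π i) eq (from (perm-inv V i j i<j) m)))
              (λ m → let i<j = Inv⇒< u m in
                 to (perm-inv V i j i<j) (subst (λ π → lookup π j < lookup π i) (sym eq) (from (perm-inv U i j i<j) m)))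

-- Surjectivity: reading a word off an avoiding permutation.

module _ (π : Vec ℕ n) (P : InS2413-4213 π) where

  private
    val : Fin n → ℕ
    val = lookup π

  -- A value inserted between two earlier values y < x, after an entry smaller than both, completes a 2413 or a 4213.
  no-split : ∀ {a b c d} → a <ᶠ c → b <ᶠ c → c <ᶠ d → val c < val b → val b < val d → val d < val a → ⊥
  no-split {a} {b} {c} {d} a<c b<c c<d c<πb b<πd d<πa with <ᶠ-cmp a b
  ... | tri< a<b _ _ = proj₂ (proj₂ P) (a , b , c , d , a<b , b<c , c<d , c<πb , b<πd , d<πa)
  ... | tri≈ _ refl _ = <-asym b<πd d<πa
  ... | tri> _ _ b<a = proj₁ (proj₂ P) (b , a , c , d , b<a , a<c , c<d , c<πb , b<πd , d<πa)

  cmp : ∀ {i j} → i <ᶠ j → val j < val i ⊎ val i < val j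
  cmp {i} {j} i<j with <-cmp (val j) (val i)
  ... | tri< lt _ _ = inj₁ lt
  ... | tri≈ _ eq _ = contradiction (cong toℕ (sym (proj₂ (proj₁ P) j i eq))) (<⇒≢ i<j)
  ... | tri> _ _ gt = inj₂ gt

  insertAt : ℕ → Fin n → (ℕ → Fin n) → ℕ → Fin n
  insertAt g v θ β with <-cmp β g
  ... | tri< _ _ _ = θ β
  ... | tri≈ _ _ _ = v
  ... | tri> _ _ _ = θ (pred β)

  insertAt-< : ∀ {g v} θ → β < g → insertAt g v θ β ≡ θ β
  insertAt-< {β} {g} θ β<g with <-cmp β g
  ... | tri< _ _ _ = refl
  ... | tri≈ ¬p _ _ = contradiction β<g ¬p
  ... | tri> ¬p _ _ = contradiction β<g ¬p

  insertAt-≡ : ∀ g {v} θ → insertAt g v θ g ≡ v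
  insertAt-≡ g θ with <-cmp g g
  ... | tri< _ ¬p _ = contradiction refl ¬p
  ... | tri≈ _ _ _ = refl
  ... | tri> _ ¬p _ = contradiction refl ¬p

  insertAt-suc : ∀ g {v} θ → insertAt g v θ (suc g) ≡ θ g
  insertAt-suc g θ with <-cmp (suc g) g
  ... | tri< _ _ ¬p = contradiction ≤-refl ¬p
  ... | tri≈ _ _ ¬p = contradiction ≤-refl ¬p
  ... | tri> _ _ _ = refl

  -- θ β is the position of the least earlier value above the β-th lowest place where a later
  -- value can still go without completing a pattern; M is the position of the largest earlier value.
  record State {r} (emb : Fin r → Fin n) (h : ℕ) (θ : ℕ → Fin n) (M : Fin n) : Set where
    field
      1≤h   : 1 ≤ h
      incr  : ∀ {β γ} → 1 ≤ β → β < γ → γ ≤ h → val (θ β) < val (θ γ)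
      top   : ∀ {β} → 1 ≤ β → β ≤ h → val (θ β) ≤ val M
      early : ∀ {β} → 1 ≤ β → β ≤ h → ∀ j → θ β <ᶠ emb j
      max   : ∀ j → M <ᶠ emb j
      gap   : ∀ j → val (emb j) < val (θ h) ⊎ val M < val (emb j)

  Represents : ∀ {r} → (Fin r → Fin n) → Word r → Set
  Represents emb w = ∀ i j → i <ᶠ j → val (emb j) < val (emb i) ⇔ Inv w i j

  -- Finds the place that receives the value `v`.
  least : ∀ v {θ : ℕ → Fin n} h → 1 ≤ h →
          (∀ {β γ} → 1 ≤ β → β < γ → γ ≤ h → val (θ β) < val (θ γ)) → v < val (θ h) →
          ∃[ g ] (1 ≤ g × g ≤ h × v < val (θ g) × (∀ {β} → 1 ≤ β → β < g → ¬ v < val (θ β)))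
  least v {θ} (suc h) _ incr lt with 1 ≤? h | v <? val (θ h)
  ... | yes 1≤h | yes lt′ =
    let g , 1≤g , g≤h , v<g , min = least v h 1≤h (λ 1≤β β<γ γ≤h → incr 1≤β β<γ (m≤n⇒m≤1+n γ≤h)) lt′
    in g , 1≤g , m≤n⇒m≤1+n g≤h , v<g , min
  ... | no 1≰h | _ = suc h , s≤s z≤n , ≤-refl , lt , λ 1≤β β≤h → contradiction (≤-trans 1≤β (s≤s⁻¹ β≤h)) 1≰h
  ... | yes _ | no ¬lt′ = suc h , s≤s z≤n , ≤-refl , lt , min
    where
    min : ∀ {β} → 1 ≤ β → β < suc h → ¬ v < val (θ β)
    min {β} 1≤β (s≤s β≤h) v<β with m≤n⇒m<n∨m≡n β≤h
    ... | inj₁ β<h = ¬lt′ (<-trans v<β (incr 1≤β β<h (n≤1+n h)))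
    ... | inj₂ refl = ¬lt′ v<β

  ≤suc-cases : ∀ {β g} → β ≤ suc g → β < g ⊎ β ≡ g ⊎ β ≡ suc g
  ≤suc-cases β≤ with m≤n⇒m<n∨m≡n β≤
  ... | inj₂ eq = inj₂ (inj₂ eq)
  ... | inj₁ (s≤s β≤g) with m≤n⇒m<n∨m≡n β≤g
  ...   | inj₁ β<g = inj₁ β<g
  ...   | inj₂ eq = inj₂ (inj₁ eq)

  -- Recursion along the positions. A new maximum gives a letter Z and opens a place just below
  -- itself. Any other value enters some place `g`, which splits into `g` and `suc g`; the higher
  -- places close, apart from the top.
  build : ∀ {r h θ M} (emb : Fin r → Fin n) → (∀ {i j} → i <ᶠ j → emb i <ᶠ emb j) → State emb h θ M →
          ∃[ w ] (Valid h w × (∀ {β} → 1 ≤ β → β ≤ h → ∀ j → val (emb j) < val (θ β) ⇔ j ∈ below β w) ×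
                  Represents emb w)
  build {zero} emb mono S = [] , [] , (λ _ _ ()) , λ ()
  build {suc r} {h} {θ} {M} emb mono S with State.gap S zero
  ... | inj₂ M<v = Z (suc h) ∷ w , zer valid , outer , inner
    where
    open State S
    v = emb zero
    θ′ = insertAt (suc h) v θ
    later : ∀ j → v <ᶠ emb (suc j)
    later j = mono (s≤s z≤n)
    old : ∀ {β} → β ≤ h → θ′ β ≡ θ β
    old β≤h = insertAt-< θ (s≤s β≤h)
    new : θ′ (suc h) ≡ v
    new = insertAt-≡ (suc h) θ
    S′ : State (emb ∘ suc) (suc h) θ′ v
    S′ .State.1≤h = s≤s z≤n
    S′ .State.incr 1≤β β<γ γ≤ with m≤n⇒m<n∨m≡n γ≤
    ... | inj₁ (s≤s γ≤h) rewrite old γ≤h | old (≤-trans (<⇒≤ β<γ) γ≤h) = incr 1≤β β<γ γ≤h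
    ... | inj₂ refl rewrite new | old (s≤s⁻¹ β<γ) = ≤-<-trans (top 1≤β (s≤s⁻¹ β<γ)) M<v
    S′ .State.top 1≤β β≤ with m≤n⇒m<n∨m≡n β≤
    ... | inj₁ (s≤s β≤h) rewrite old β≤h = ≤-trans (top 1≤β β≤h) (<⇒≤ M<v)
    ... | inj₂ refl rewrite new = ≤-refl
    S′ .State.early 1≤β β≤ j with m≤n⇒m<n∨m≡n β≤
    ... | inj₁ (s≤s β≤h) rewrite old β≤h = early 1≤β β≤h (suc j)
    ... | inj₂ refl rewrite new = later j
    S′ .State.max j = later j
    S′ .State.gap j rewrite new = cmp (later j)
    rec = build (emb ∘ suc) (mono ∘ s≤s) S′
    w = proj₁ rec
    valid = proj₁ (proj₂ rec)
    outer : ∀ {β} → 1 ≤ β → β ≤ h → ∀ j → val (emb j) < val (θ β) ⇔ j ∈ below β (Z (suc h) ∷ w)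
    outer 1≤β β≤h zero = mk⇔ (λ lt → contradiction (<-≤-trans lt (top 1≤β β≤h)) (<-asym M<v)) λ ()
    outer {β} 1≤β β≤h (suc j) with proj₁ (proj₂ (proj₂ rec)) 1≤β (m≤n⇒m≤1+n β≤h) j
    ... | eqv rewrite old β≤h = mk⇔ (there ∘ to eqv) (from eqv ∘ drop-there)
    inner : Represents emb (Z (suc h) ∷ w)
    inner zero (suc j) _ with proj₁ (proj₂ (proj₂ rec)) (s≤s z≤n) ≤-refl j
    ... | eqv rewrite new = eqv
    inner (suc i) (suc j) (s≤s i<j) = proj₂ (proj₂ (proj₂ rec)) i j i<j
  ... | inj₁ v<h with least (val (emb zero)) h (State.1≤h S) (State.incr S) v<h
  ...   | g , 1≤g , g≤h , v<g , min = N (suc g) ∷ w , nz (s≤s 1≤g) (s≤s g≤h) valid , outer , inner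
    where
    open State S
    v = emb zero
    θ′ = insertAt g v θ
    later : ∀ j → v <ᶠ emb (suc j)
    later j = mono (s≤s z≤n)
    old : ∀ {β} → β < g → θ′ β ≡ θ β
    old = insertAt-< θ
    new : θ′ g ≡ v
    new = insertAt-≡ g θ
    shifted : θ′ (suc g) ≡ θ g
    shifted = insertAt-suc g θ
    θ<v : ∀ {β} → 1 ≤ β → β < g → val (θ β) < val v
    θ<v 1≤β β<g with cmp (early 1≤β (≤-trans (<⇒≤ β<g) g≤h) zero)
    ... | inj₁ lt = contradiction lt (min 1≤β β<g)
    ... | inj₂ gt = gt
    -- A later value between those at `θ g` and `θ β` would split them after the smaller entry `v`,
    -- against `no-split`.
    closed : ∀ {β} → g ≤ β → β ≤ h → ∀ j → val (emb (suc j)) < val (θ β) → val (emb (suc j)) < val (θ g)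
    closed {β} g≤β β≤h j lt with cmp (early 1≤g g≤h (suc j))
    ... | inj₁ lt′ = lt′
    ... | inj₂ gt = ⊥-elim (no-split (early (≤-trans 1≤g g≤β) β≤h zero) (early 1≤g g≤h zero) (later j) v<g gt lt)
    S′ : State (emb ∘ suc) (suc g) θ′ M
    S′ .State.1≤h = s≤s z≤n
    S′ .State.incr 1≤β β<γ γ≤ with ≤suc-cases γ≤
    ... | inj₁ γ<g rewrite old γ<g | old (<-trans β<γ γ<g) = incr 1≤β β<γ (≤-trans (<⇒≤ γ<g) g≤h)
    ... | inj₂ (inj₁ refl) rewrite new | old β<γ = θ<v 1≤β β<γ
    ... | inj₂ (inj₂ refl) with m≤n⇒m<n∨m≡n (s≤s⁻¹ β<γ)
    ...   | inj₁ β<g rewrite shifted | old β<g = incr 1≤β β<g g≤h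
    ...   | inj₂ refl rewrite shifted | new = v<g
    S′ .State.top 1≤β β≤ with ≤suc-cases β≤
    ... | inj₁ β<g rewrite old β<g = top 1≤β (≤-trans (<⇒≤ β<g) g≤h)
    ... | inj₂ (inj₁ refl) rewrite new = ≤-trans (<⇒≤ v<g) (top 1≤g g≤h)
    ... | inj₂ (inj₂ refl) rewrite shifted = top 1≤g g≤h
    S′ .State.early 1≤β β≤ j with ≤suc-cases β≤
    ... | inj₁ β<g rewrite old β<g = early 1≤β (≤-trans (<⇒≤ β<g) g≤h) (suc j)
    ... | inj₂ (inj₁ refl) rewrite new = later j
    ... | inj₂ (inj₂ refl) rewrite shifted = early 1≤g g≤h (suc j)
    S′ .State.max j = max (suc j)
    S′ .State.gap j rewrite shifted with gap (suc j)
    ... | inj₂ M< = inj₂ M<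
    ... | inj₁ lt = inj₁ (closed g≤h ≤-refl j lt)
    rec = build (emb ∘ suc) (mono ∘ s≤s) S′
    w = proj₁ rec
    valid = proj₁ (proj₂ rec)
    outer : ∀ {β} → 1 ≤ β → β ≤ h → ∀ j → val (emb j) < val (θ β) ⇔ j ∈ below β (N (suc g) ∷ w)
    outer {β} 1≤β β≤h j with g ≤? β
    outer {β} 1≤β β≤h zero | yes g≤β = mk⇔ (λ _ → head∈below (s≤s g≤β)) (λ _ → v<β)
      where
      v<β : val v < val (θ β)
      v<β with m≤n⇒m<n∨m≡n g≤β
      ... | inj₁ g<β = <-trans v<g (incr 1≤g g<β β≤h)
      ... | inj₂ refl = v<g
    outer {β} 1≤β β≤h zero | no g≰β =
      mk⇔ (λ lt → contradiction lt (min 1≤β (≰⇒> g≰β))) (λ m → contradiction (s≤s⁻¹ (∈below-head m)) g≰β)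
    outer {β} 1≤β β≤h (suc j) | yes g≤β with proj₁ (proj₂ (proj₂ rec)) (s≤s z≤n) ≤-refl j
    -- By `closed`, later values see every threshold `θ β` with `g ≤ β` as `θ g`; this is why
    -- `below` continues with the level of the letter.
    ... | eqv rewrite shifted = mk⇔ (from (∈below-in (s≤s g≤β)) ∘ to eqv ∘ closed g≤β β≤h j)
                                    (widen ∘ from eqv ∘ to (∈below-in (s≤s g≤β)))
      where
      widen : val (emb (suc j)) < val (θ g) → val (emb (suc j)) < val (θ β)
      widen lt with m≤n⇒m<n∨m≡n g≤β
      ... | inj₁ g<β = <-trans lt (incr 1≤g g<β β≤h)
      ... | inj₂ refl = lt
    outer {β} 1≤β β≤h (suc j) | no g≰β
      with proj₁ (proj₂ (proj₂ rec)) 1≤β (m≤n⇒m≤1+n (<⇒≤ (≰⇒> g≰β))) j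
    ... | eqv rewrite old (≰⇒> g≰β) = mk⇔ (from (∈below-out (s≤s (≰⇒> g≰β))) ∘ to eqv)
                                          (from eqv ∘ to (∈below-out (s≤s (≰⇒> g≰β))))
    inner : Represents emb (N (suc g) ∷ w)
    inner zero (suc j) _ with proj₁ (proj₂ (proj₂ rec)) 1≤g (n≤1+n g) j
    ... | eqv rewrite new = eqv
    inner (suc i) (suc j) (s≤s i<j) = proj₂ (proj₂ (proj₂ rec)) i j i<j

perm-onto : (π : Vec ℕ n) → InS2413-4213 π → ∃[ w ] (Valid 0 w × perm w ≡ π)
perm-onto [] P = [] , [] , refl
perm-onto (p ∷ π) P = Z 1 ∷ w , V , inversions-determine _ _ (perm-isPermutation (Z 1 ∷ w)) (proj₁ P)
    (λ i j i<j → mk⇔ (from (rep i j i<j) ∘ to (perm-inv V i j i<j)) (from (perm-inv V i j i<j) ∘ to (rep i j i<j)))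
  where
  -- After the first value one place is open below it, and this value is both its threshold and the
  -- maximum.
  S : State (p ∷ π) P suc 1 (λ _ → zero) zero
  S = record
    { 1≤h = ≤-refl
    ; incr = λ 1≤β β<γ γ≤1 → contradiction (≤-trans (s≤s 1≤β) (≤-trans β<γ γ≤1)) λ { (s≤s ()) }
    ; top = λ _ _ → ≤-refl
    ; early = λ _ _ _ → s≤s z≤n
    ; max = λ _ → s≤s z≤n
    ; gap = λ j → cmp (p ∷ π) P {zero} {suc j} (s≤s z≤n)
    }
  rec = build (p ∷ π) P suc s≤s S
  w = proj₁ rec
  V = zer (proj₁ (proj₂ rec))
  rep : Represents (p ∷ π) P (λ i → i) (Z 1 ∷ w)
  rep zero (suc j) _ = proj₁ (proj₂ (proj₂ rec)) ≤-refl ≤-refl j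
  rep (suc i) (suc j) (s≤s i<j) = proj₂ (proj₂ (proj₂ rec)) i j i<j

-- Statistics of the permutation on its word.

At : (∀ {m} → Letter → Word m → Set) → Word n → Fin n → Set
At P (x ∷ w) zero = P x w
At P (x ∷ w) (suc i) = At P w i

-- `IsN2` is insertion at the lowest place. `Vid` says that no later value enters just above the
-- letter, so that the next larger value stands to its left.
IsZ IsN IsN2 Vid Des Rmi : Letter → Word n → Set
IsZ (Z _) _ = ⊤
IsZ (N _) _ = ⊥
IsN (Z _) _ = ⊥
IsN (N _) _ = ⊤
IsN2 (Z _) _ = ⊥
IsN2 (N k) _ = k ≡ 2
Vid (Z _) _ = ⊥
Vid (N k) w = below k w ≡ below (pred k) w
Des x w = ∃[ j ] (toℕ j ≡ 0 × j ∈ below (base x) w)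
Rmi x w = ∀ j → j ∉ below (base x) w

Inv⇔Des : (w : Word n) (i : Fin n) → (∃[ j ] (toℕ j ≡ suc (toℕ i) × Inv w i j)) ⇔ At Des w i
Inv⇔Des (x ∷ w) zero = mk⇔ (λ { (suc j , eq , m) → j , suc-injective eq , m })
                           (λ (j , eq , m) → suc j , cong suc eq , m)
Inv⇔Des (x ∷ w) (suc i) = mk⇔
  (λ { (suc j , eq , m) → to (Inv⇔Des w i) (j , suc-injective eq , m) })
  (λ d → let j , eq , m = from (Inv⇔Des w i) d in suc j , cong suc eq , m)

Inv⇔Rmi : (w : Word n) (i : Fin n) → (∀ j → ¬ Inv w i j) ⇔ At Rmi w i
Inv⇔Rmi (x ∷ w) zero = mk⇔ (λ f j → f (suc j)) λ { f (suc j) → f j }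
Inv⇔Rmi (x ∷ w) (suc i) = mk⇔ (λ f → to (Inv⇔Rmi w i) (λ j → f (suc j)))
                              λ { f (suc j) → from (Inv⇔Rmi w i) f j }

Z∉below : (w : Word n) {i : Fin n} → At IsZ w i → i ∉ below β w
Z∉below (Z _ ∷ w) {zero} _ ()
Z∉below (Z _ ∷ w) {suc i} z (there m) = Z∉below w z m
Z∉below {β = β} (N k ∷ w) {suc i} z m with k ≤? suc β
Z∉below (N k ∷ w) {suc i} z (there m) | yes _ = Z∉below w z m
Z∉below (N k ∷ w) {suc i} z (there m) | no _ = Z∉below w z m

Z-noInv : (w : Word n) {i j : Fin n} → At IsZ w j → ¬ Inv w i j
Z-noInv (x ∷ w) {zero} {suc j} z m = Z∉below w z m
Z-noInv (x ∷ w) {suc i} {suc j} z m = Z-noInv w z m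

isZ? : (w : Word n) (i : Fin n) → At IsZ w i ⊎ At IsN w i
isZ? (Z _ ∷ w) zero = inj₁ tt
isZ? (N _ ∷ w) zero = inj₂ tt
isZ? (x ∷ w) (suc i) = isZ? w i

-- The latest Z before a letter N is inverted with it.
N-inverted : {w : Word n} → Valid h w → (i : Fin n) → At IsN w i → i ∈ below h w ⊎ ∃[ j ] Inv w j i
N-inverted (zer v) (suc i) a with N-inverted v i a
... | inj₁ m = inj₂ (zero , m)
... | inj₂ (j , m) = inj₂ (suc j , m)
N-inverted (nz _ k≤ _) zero _ = inj₁ (head∈below k≤)
N-inverted (nz _ k≤ v) (suc i) a with N-inverted v i a
... | inj₁ m = inj₁ (from (∈below-in k≤) m)
... | inj₂ (j , m) = inj₂ (suc j , m)

N-inverted₀ : {w : Word n} → Valid 0 w → (i : Fin n) → At IsN w i → ∃[ j ] Inv w j i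
N-inverted₀ (nz 2≤k k≤1 _) _ _ = contradiction (≤-trans 2≤k k≤1) λ { (s≤s ()) }
N-inverted₀ (zer v) (suc i) a with N-inverted v i a
... | inj₁ m = zero , m
... | inj₂ (j , m) = suc j , m

N2∈below : {w : Word n} → Valid h w → 1 ≤ β → (i : Fin n) → At IsN2 w i → i ∈ below β w
N2∈below (zer v) 1≤β (suc i) a = there (N2∈below v 1≤β i a)
N2∈below (nz _ _ _) 1≤β zero refl = head∈below (s≤s 1≤β)
N2∈below {β = β} (nz {k = k} 2≤k _ v) 1≤β (suc i) a with k ≤? suc β
... | yes _ = there (N2∈below v (<⇒≤ 2≤k) i a)
... | no _ = there (N2∈below v 1≤β i a)

N2-Inv : {w : Word n} → Valid h w → (i j : Fin n) → i <ᶠ j → At IsN2 w j → Inv w i j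
N2-Inv {w = x ∷ w} V i j i<j a with base≤ V
N2-Inv {w = x ∷ w} V zero (suc j) _ a | _ , v , _ , 1≤b = N2∈below v 1≤b j a
N2-Inv {w = x ∷ w} V (suc i) (suc j) (s≤s i<j) a | _ , v , _ = N2-Inv v i j i<j a

-- The threshold of place 1 is not above such a letter. This threshold is the latest earlier `N 2`
-- or, failing that, the one given before the word starts, which is the left alternative.
¬N2-notInverted : {w : Word n} → Valid h w → (i : Fin n) → ¬ At IsN2 w i →
                  i ∉ below 1 w ⊎ ∃[ j ] (j <ᶠ i × ¬ Inv w j i)
¬N2-notInverted (zer v) zero a = inj₁ λ ()
¬N2-notInverted (zer v) (suc i) a with ¬N2-notInverted v i a
... | inj₁ m = inj₁ (m ∘ drop-there)
... | inj₂ (j , j<i , m) = inj₂ (suc j , s≤s j<i , m)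
¬N2-notInverted (nz 2≤k _ _) zero a = inj₁ λ m → a (≤-antisym (∈below-head m) 2≤k)
¬N2-notInverted (nz 2≤k _ v) (suc i) a with ¬N2-notInverted v i a
... | inj₂ (j , j<i , m) = inj₂ (suc j , s≤s j<i , m)
... | inj₁ m with m≤n⇒m<n∨m≡n 2≤k
...   | inj₁ 2<k = inj₁ (m ∘ to (∈below-out 2<k))
...   | inj₂ refl = inj₂ (zero , s≤s z≤n , m)

-- For a letter N, `After` refers to the place just above it and `Inv` to the place just below;
-- `Vid` makes them agree.
After⇒Inv : (w : Word n) (i : Fin n) → At Vid w i → ∀ {d} → After w i d → Inv w i d
After⇒Inv (N k ∷ w) zero eq {suc d} m = subst (d ∈_) eq m
After⇒Inv (x ∷ w) (suc i) a {suc d} m = After⇒Inv w i a m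

After⊆Inv⇒Vid : (w : Word n) (i : Fin n) → At IsN w i → (∀ {d} → i <ᶠ d → After w i d → Inv w i d) → At Vid w i
After⊆Inv⇒Vid (N k ∷ w) zero _ f = ⊆-antisym (f (s≤s z≤n)) (below-mono w pred[n]≤n)
After⊆Inv⇒Vid (x ∷ w) (suc i) a f = After⊆Inv⇒Vid w i a (f ∘ s≤s)

Vid⇒N : (w : Word n) (i : Fin n) → At Vid w i → At IsN w i
Vid⇒N (N _ ∷ w) zero _ = tt
Vid⇒N (x ∷ w) (suc i) a = Vid⇒N w i a

module _ {w : Word n} (V : Valid 0 w) where

  private
    π = perm w

  notInv⇒< : ∀ {i j} → i <ᶠ j → ¬ Inv w i j → lookup π i < lookup π j
  notInv⇒< {i} {j} i<j ¬m with cmp π (perm-avoids V) i<j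
  ... | inj₁ lt = contradiction (to (perm-inv V i j i<j) lt) ¬m
  ... | inj₂ gt = gt

  Inv⇒> : ∀ {i j} → Inv w i j → lookup π j < lookup π i
  Inv⇒> m = from (perm-inv V _ _ (Inv⇒< w m)) m

  DES⇔ : ∀ i → DES π i ⇔ At Des w i
  DES⇔ i = mk⇔
    (λ (j , eq , lt) → to (Inv⇔Des w i) (j , eq , to (perm-inv V i j (≤-reflexive (sym eq))) lt))
    (λ d → let j , eq , m = from (Inv⇔Des w i) d in j , eq , Inv⇒> m)

  RMI⇔ : ∀ i → RMIπ π i ⇔ At Rmi w i
  RMI⇔ i = mk⇔ (λ f → to (Inv⇔Rmi w i) λ j m → <-asym (f j (Inv⇒< w m)) (Inv⇒> m))
               (λ f j i<j → notInv⇒< i<j (from (Inv⇔Rmi w i) f j))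

  LMA⇔ : ∀ i → LMA π i ⇔ At IsZ w i
  LMA⇔ i = mk⇔ forward (λ z j j<i → notInv⇒< j<i (Z-noInv w z))
    where
    forward : LMA π i → At IsZ w i
    forward f with isZ? w i
    ... | inj₁ z = z
    ... | inj₂ a = let j , m = N-inverted₀ V i a in contradiction (Inv⇒> m) (<-asym (f j (Inv⇒< w m)))

  LMI⇔ : ∀ i → LMI π i ⇔ (toℕ i ≡ 0 ⊎ At IsN2 w i)
  LMI⇔ i = mk⇔ (forward V i ∘ λ f j j<i → to (perm-inv V j i j<i) (f j j<i)) λ
    { (inj₁ eq) j j<i → contradiction (subst (toℕ j <_) eq j<i) λ ()
    ; (inj₂ a) j j<i → Inv⇒> (N2-Inv V j i j<i a) }
    where
    isN2? : ∀ {n} (w : Word n) i → Dec (At IsN2 w i)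
    isN2? (Z _ ∷ w) zero = no λ ()
    isN2? (N k ∷ w) zero = k ≟ 2
    isN2? (x ∷ w) (suc i) = isN2? w i
    forward : ∀ {n} {w : Word n} → Valid 0 w → ∀ i → (∀ j → j <ᶠ i → Inv w j i) → toℕ i ≡ 0 ⊎ At IsN2 w i
    forward V zero _ = inj₁ refl
    forward (nz 2≤k k≤1 _) (suc i) f = contradiction (≤-trans 2≤k k≤1) λ { (s≤s ()) }
    forward {w = _ ∷ w} (zer v) (suc i) f with isN2? w i
    ... | yes a = inj₂ a
    ... | no ¬a with ¬N2-notInverted v i ¬a
    ...   | inj₁ m = contradiction (f zero (s≤s z≤n)) m
    ...   | inj₂ (j , j<i , m) = contradiction (f (suc j) (s≤s j<i)) m

  VID⇔ : ∀ i → VID π i ⇔ At Vid w i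
  VID⇔ i = mk⇔ forward backward
    where
    forward : VID π i → At Vid w i
    -- A value that is `After` `i` lies below the value at `j`, which is one more than that at `i`;
    -- hence it lies below the value at `i`.
    forward (_ , j , j<i , eq) = After⊆Inv⇒Vid w i letterN
        λ {d} i<d m → to (perm-inv V i d i<d)
          (≤∧≢⇒< (s≤s⁻¹ (subst (lookup π d <_) eq (Inv⇒> (from (inv⇔After w j<i i<d inv) m))))
                 λ eq′ → <⇒≢ i<d (cong toℕ (sym (proj₂ (perm-isPermutation w) _ _ eq′))))
      where
      inv = to (perm-inv V j i j<i) (≤-reflexive (sym eq))
      letterN : At IsN w i
      letterN with isZ? w i
      ... | inj₁ z = contradiction inv (Z-noInv w z)
      ... | inj₂ a = a
    backward : At Vid w i → VID π i
    backward a with N-inverted₀ V i (Vid⇒N w i a)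
    ... | l , inv with permutation-onto π (perm-isPermutation w) {suc (lookup π i)} (s≤s z≤n)
                         (≤-trans (Inv⇒> inv) (proj₂ (proj₁ (perm-isPermutation w) l)))
    ...   | j , eq with <ᶠ-cmp j i
    ...     | tri< j<i _ _ = ≤-trans (s≤s z≤n) j<i , j , j<i , eq
    ...     | tri≈ _ refl _ = contradiction eq (<⇒≢ ≤-refl)
    -- If the successor value stood to the right of `i`, `Vid` would place it above the value at
    -- `l`, yet it is at most that value.
    ...     | tri> _ _ i<j = contradiction le (<⇒≱ gt)
      where
      notInv : ¬ Inv w i j
      notInv m = <-asym (Inv⇒> m) (≤-reflexive (sym eq))
      le = subst (_≤ lookup π l) (sym eq) (Inv⇒> inv)
      gt : lookup π l < lookup π j
      gt = notInv⇒< (<-trans (Inv⇒< w inv) i<j)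
             λ m → notInv (After⇒Inv w i a (to (inv⇔After w (Inv⇒< w inv) i<j inv) m))

-- Shifts of segments.

-- Shifts the segment of a letter of level `k`; its exit is the first N of level at most `k`, from
-- which on the word is kept.
up : ℕ → ℕ → Word n → Word n
up k δ [] = []
up k δ (Z h ∷ w) = Z (δ + h) ∷ up k δ w
up k δ (N l ∷ w) with l ≤? k
... | yes _ = N l ∷ w
... | no _  = N (δ + l) ∷ up k δ w

up-in : ∀ {δ l} {w : Word n} → k < l → up k δ (N l ∷ w) ≡ N (δ + l) ∷ up k δ w
up-in {k = k} {l = l} k<l with l ≤? k
... | yes l≤k = contradiction l≤k (<⇒≱ k<l)
... | no _ = refl

up-exit : ∀ {δ l} {w : Word n} → l ≤ k → up k δ (N l ∷ w) ≡ N l ∷ w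
up-exit {k = k} {l = l} l≤k with l ≤? k
... | yes _ = refl
... | no l≰k = contradiction l≤k l≰k

up-0 : (w : Word n) → up k 0 w ≡ w
up-0 [] = refl
up-0 (Z h ∷ w) = cong (_ ∷_) (up-0 w)
up-0 {k = k} (N l ∷ w) with l ≤? k
... | yes _ = refl
... | no _ = cong (_ ∷_) (up-0 w)

up-+ : ∀ δ ε (w : Word n) → up k δ (up k ε w) ≡ up k (δ + ε) w
up-+ δ ε [] = refl
up-+ δ ε (Z h ∷ w) = cong₂ _∷_ (cong Z (sym (+-assoc δ ε h))) (up-+ δ ε w)
up-+ {k = k} δ ε (N l ∷ w) with l ≤? k
... | yes l≤k = up-exit l≤k
... | no l≰k = trans (up-in (≤-trans (≰⇒> l≰k) (m≤n+m l ε)))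
                 (cong₂ _∷_ (cong N (sym (+-assoc δ ε l))) (up-+ δ ε w))

Z-injective : ∀ {a b} → Z a ≡ Z b → a ≡ b
Z-injective refl = refl

N-injective : ∀ {a b} → N a ≡ N b → a ≡ b
N-injective refl = refl

up-injective : ∀ δ (w u : Word n) → up k δ w ≡ up k δ u → w ≡ u
up-injective δ [] [] _ = refl
up-injective δ (Z h ∷ w) (Z g ∷ u) eq =
  cong₂ _∷_ (cong Z (+-cancelˡ-≡ δ _ _ (Z-injective (∷-injectiveˡ eq)))) (up-injective δ w u (∷-injectiveʳ eq))
up-injective {k = k} δ (Z h ∷ w) (N l ∷ u) eq with l ≤? k
up-injective δ (Z h ∷ w) (N l ∷ u) () | yes _
up-injective δ (Z h ∷ w) (N l ∷ u) () | no _
up-injective {k = k} δ (N l ∷ w) (Z h ∷ u) eq with l ≤? k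
up-injective δ (N l ∷ w) (Z h ∷ u) () | yes _
up-injective δ (N l ∷ w) (Z h ∷ u) () | no _
up-injective {k = k} δ (N l ∷ w) (N m ∷ u) eq with l ≤? k | m ≤? k
... | yes _ | yes _ = eq
... | yes l≤k | no m≰k = contradiction (≤-trans (m≤n+m m δ) (subst (_≤ k) (N-injective (∷-injectiveˡ eq)) l≤k)) m≰k
... | no l≰k | yes m≤k = contradiction (≤-trans (m≤n+m l δ) (subst (_≤ k) (sym (N-injective (∷-injectiveˡ eq))) m≤k)) l≰k
... | no _ | no _ =
  cong₂ _∷_ (cong N (+-cancelˡ-≡ δ _ _ (N-injective (∷-injectiveˡ eq)))) (up-injective δ w u (∷-injectiveʳ eq))

up-valid : ∀ δ {w : Word n} → Valid h w → Valid (δ + h) (up k δ w)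
up-valid δ [] = []
up-valid {h = h} δ (zer v) with up-valid δ v
... | v′ rewrite +-suc δ h = zer v′
up-valid {h = h} {k = k} δ (nz {k = l} 2≤l l≤ v) with l ≤? k
... | yes _ = nz 2≤l (≤-trans l≤ (s≤s (m≤n+m h δ))) v
... | no _ = nz (≤-trans 2≤l (m≤n+m l δ)) (≤-trans (+-monoʳ-≤ δ l≤) (≤-reflexive (+-suc δ h))) (up-valid δ v)

-- Some letter N before the exit below level suc k has the least possible level.
data HasMin (k : ℕ) : ∀ {n} → Word n → Set where
  here : {w : Word n} → HasMin k (N (suc k) ∷ w)
  overZ : ∀ {h} {w : Word n} → HasMin k w → HasMin k (Z h ∷ w)
  overN : ∀ {l} {w : Word n} → k < l → HasMin k w → HasMin k (N l ∷ w)

-- Letters N of the segment have levels above `k`, hence above `suc k` after a positive shift.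
up-noMin : ∀ δ (w : Word n) → ¬ HasMin k (up k (suc δ) w)
up-noMin δ (Z _ ∷ w) (overZ m) = up-noMin δ w m
up-noMin {k = k} δ (N l ∷ w) m with l ≤? k
up-noMin δ (N l ∷ w) here | yes l≤k = 1+n≰n l≤k
up-noMin δ (N l ∷ w) (overN k<l _) | yes l≤k = <⇒≱ k<l l≤k
up-noMin δ (N l ∷ w) (overN _ m) | no _ = up-noMin δ w m
up-noMin {k = k} δ (N l ∷ w) m | no l≰k = go refl m
  where
  go : ∀ {x} → x ≡ suc δ + l → HasMin k (N x ∷ up k (suc δ) w) → ⊥
  go eq here = l≰k (subst (l ≤_) (sym (suc-injective eq)) (m≤n+m l δ))
  go eq (overN _ m) = up-noMin δ w m

-- If level `suc k` is missed, all levels N of the segment are at least `k + 2`, and lowering them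
-- by one keeps them inside it.
min-or-up : {w : Word n} → 1 ≤ k → k ≤ h → Valid (suc h) w →
            HasMin k w ⊎ ∃[ u ] (w ≡ up k 1 u × Valid h u)
min-or-up 1≤k k≤h [] = inj₂ ([] , refl , [])
min-or-up 1≤k k≤h (zer v) with min-or-up 1≤k (m≤n⇒m≤1+n k≤h) v
... | inj₁ m = inj₁ (overZ m)
... | inj₂ (u , eq , v′) = inj₂ (Z _ ∷ u , cong (_ ∷_) eq , zer v′)
min-or-up {k = k} 1≤k k≤h (nz {k = l} 2≤l l≤ v) with <-cmp l (suc k)
... | tri< (s≤s l≤k) _ _ = inj₂ (N l ∷ _ , sym (up-exit l≤k) , nz 2≤l (≤-trans l≤k (m≤n⇒m≤1+n k≤h)) v)
... | tri≈ _ refl _ = inj₁ here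
min-or-up {k = k} 1≤k k≤h (nz {k = suc l} 2≤l l≤ v) | tri> _ _ (s≤s k<l) with min-or-up 1≤k (<⇒≤ k<l) v
... | inj₁ m = inj₁ (overN (m≤n⇒m≤1+n k<l) m)
... | inj₂ (u , eq , v′) = inj₂ (N l ∷ u , trans (cong (_ ∷_) eq) (sym (up-in k<l)) ,
                                 nz (≤-trans (s≤s 1≤k) k<l) (s≤s⁻¹ l≤) v′)

-- Iterates `min-or-up`; the descent ends at the latest when the head itself reaches `suc k`.
lowest : ∀ l {u : Word n} → 1 ≤ k → k < l → Valid l u →
  ∃[ δ ] ∃[ l₀ ] ∃[ u₀ ] (N l ∷ u ≡ up k δ (N l₀ ∷ u₀) × k < l₀ × HasMin k (N l₀ ∷ u₀) × Valid l₀ u₀ × δ + l₀ ≡ l)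
lowest {k = k} (suc l) {u} 1≤k (s≤s k≤l) v with m≤n⇒m<n∨m≡n k≤l
... | inj₂ refl = 0 , suc l , u , sym (up-0 _) , ≤-refl , here , v , refl
... | inj₁ k<l with min-or-up 1≤k k≤l v
...   | inj₁ m = 0 , suc l , u , sym (up-0 _) , s≤s k≤l , overN (s≤s k≤l) m , v , refl
...   | inj₂ (u′ , refl , v′) =
  let δ , l₀ , u₀ , eq , k<l₀ , m , v₀ , eq′ = lowest l 1≤k k<l v′
  in suc δ , l₀ , u₀ , trans (sym (up-in k<l)) (trans (cong (up k 1) eq) (up-+ 1 δ _)) , k<l₀ , m , v₀ , cong suc eq′

-- Adjusting one segment.

-- The shift of the segment of a preceding letter N k, with current level h: it starts after the
-- leading letters Z, where h has become the level of the last one of them.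
data Adj (k : ℕ) : ∀ {n} → ℕ → Word n → Word n → Set where
  nil   : Adj k h [] []
  zer   : {u u′ : Word n} → Adj k (suc h) u u′ → Adj k h (Z (suc h) ∷ u) (Z (suc h) ∷ u′)
  exit  : ∀ {l} {u : Word n} → l ≤ k → Adj k h (N l ∷ u) (N l ∷ u)
  raise : ∀ {l} {u u′ : Word n} → k < l → l ≤ h → u′ ≡ up k 1 u → Adj k h (N l ∷ u) (N (suc l) ∷ u′)
  lower : ∀ {l m} {u u′ : Word n} δ → k < l → m ≡ suc h → m ≡ δ + l → u ≡ up k δ u′ → HasMin k (N l ∷ u′) →
          Adj k h (N m ∷ u) (N l ∷ u′)

adjust : {u : Word n} → 1 ≤ k → k ≤ h → Valid h u → ∃[ u′ ] (Adj k h u u′ × Valid h u′)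
adjust 1≤k k≤h [] = [] , nil , []
adjust 1≤k k≤h (zer v) = let u′ , A , v′ = adjust 1≤k (m≤n⇒m≤1+n k≤h) v in Z _ ∷ u′ , zer A , zer v′
adjust {k = k} {h} 1≤k k≤h (nz {k = l} 2≤l l≤ v) with l ≤? k
... | yes l≤k = _ , exit l≤k , nz 2≤l l≤ v
... | no l≰k with m≤n⇒m<n∨m≡n l≤
...   | inj₁ (s≤s l≤h) = _ , raise (≰⇒> l≰k) l≤h refl , nz (m≤n⇒m≤1+n 2≤l) (s≤s l≤h) (up-valid 1 v)
...   | inj₂ refl with lowest (suc h) 1≤k (≰⇒> l≰k) v
...     | δ , l₀ , u₀ , eq , k<l₀ , m , v₀ , eq′ = N l₀ ∷ u₀ ,
  lower δ k<l₀ refl (sym eq′) (∷-injectiveʳ (trans eq (up-in k<l₀))) m ,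
  nz (≤-trans (s≤s 1≤k) k<l₀) (≤-trans (m≤n+m l₀ δ) (≤-reflexive eq′)) v₀

-- The occurrence of level `suc k` in the image reveals the move: lowered segments attain it, raised
-- ones do not.
unadjust : {u′ : Word n} → 1 ≤ k → k ≤ h → Valid h u′ → ∃[ u ] (Adj k h u u′ × Valid h u)
unadjust 1≤k k≤h [] = [] , nil , []
unadjust 1≤k k≤h (zer v) = let u , A , v′ = unadjust 1≤k (m≤n⇒m≤1+n k≤h) v in Z _ ∷ u , zer A , zer v′
unadjust {k = k} {h} 1≤k k≤h (nz {k = l} {w = w} 2≤l l≤ v) with l ≤? k
... | yes l≤k = _ , exit l≤k , nz 2≤l l≤ v
... | no l≰k = split (min-or-up 1≤k k≤h (nz 2≤l (m≤n⇒m≤1+n l≤) v))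
  where
  k<l = ≰⇒> l≰k
  split : HasMin k (N l ∷ w) ⊎ ∃[ u ] (N l ∷ w ≡ up k 1 u × Valid h u) →
          ∃[ u ] (Adj k h u (N l ∷ w) × Valid h u)
  -- The shift `suc h ∸ l` returns the head to the greatest possible level `suc h`.
  split (inj₁ m) = N (suc h) ∷ up k (suc h ∸ l) w , lower (suc h ∸ l) k<l refl (sym (m∸n+n≡m l≤)) refl m ,
    nz (≤-trans 2≤l l≤) ≤-refl (subst (λ x → Valid x (up k (suc h ∸ l) w)) (m∸n+n≡m l≤) (up-valid (suc h ∸ l) v))
  split (inj₂ (N m ∷ u , eq , nz 2≤m m≤ v′)) with m ≤? k
  split (inj₂ (N m ∷ u , refl , nz 2≤m m≤ v′)) | yes m≤k = contradiction m≤k l≰k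
  split (inj₂ (N m ∷ u , refl , nz 2≤m m≤ v′)) | no m≰k = N m ∷ u , raise (≰⇒> m≰k) (s≤s⁻¹ l≤) refl , nz 2≤m m≤ v′

-- Otherwise cancelling `δ` would exhibit `w` as a positive shift, which cannot attain the minimum.
up-min-≥ : ∀ δ ε {w u : Word n} → HasMin k w → up k δ w ≡ up k ε u → ε ≤ δ
up-min-≥ {k = k} δ ε {w} {u} m eq with ε ≤? δ
... | yes ε≤δ = ε≤δ
... | no ε≰δ with m≤n⇒∃[o]m+o≡n (≰⇒> ε≰δ)
...   | o , refl = contradiction (subst (HasMin k) w≡ m) (up-noMin o u)
  where
  w≡ : w ≡ up k (suc o) u
  w≡ = up-injective δ w _ (trans eq (trans (cong (λ x → up k x u) (sym (+-suc δ o))) (sym (up-+ δ (suc o) u))))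

Adj-functional : {u v v′ : Word n} → Adj k h u v → Adj k h u v′ → v ≡ v′
Adj-functional nil nil = refl
Adj-functional (zer A) (zer A′) = cong (_ ∷_) (Adj-functional A A′)
Adj-functional (exit _) (exit _) = refl
Adj-functional (exit l≤k) (raise k<l _ _) = contradiction l≤k (<⇒≱ k<l)
Adj-functional (exit m≤k) (lower δ k<l _ eq _ _) = contradiction (≤-trans (m≤n+m _ δ) (subst (_≤ _) eq m≤k)) (<⇒≱ k<l)
Adj-functional (raise k<l _ _) (exit l≤k) = contradiction l≤k (<⇒≱ k<l)
Adj-functional (raise _ _ refl) (raise _ _ refl) = refl
Adj-functional (raise _ l≤h _) (lower _ _ refl _ _ _) = contradiction l≤h 1+n≰n
Adj-functional (lower δ k<l _ eq _ _) (exit m≤k) = contradiction (≤-trans (m≤n+m _ δ) (subst (_≤ _) eq m≤k)) (<⇒≱ k<l)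
Adj-functional (lower _ _ refl _ _ _) (raise _ l≤h _) = contradiction l≤h 1+n≰n
-- Both results attain the minimum, so neither shift exceeds the other.
Adj-functional {k = k} (lower {l = l} {u′ = u} δ k<l _ eq₁ eq₂ m) (lower {l = l′} {u′ = u′} ε k<l′ _ eq₁′ eq₂′ m′)
  with ≤-antisym (up-min-≥ ε δ m′ (sym eq)) (up-min-≥ δ ε m eq)
  where
  eq : up k δ (N l ∷ u) ≡ up k ε (N l′ ∷ u′)
  eq = trans (up-in k<l) (trans (cong₂ (λ x y → N x ∷ y) (trans (sym eq₁) eq₁′) (trans (sym eq₂) eq₂′))
         (sym (up-in k<l′)))
... | refl = cong₂ (λ x y → N x ∷ y) (+-cancelˡ-≡ δ _ _ (trans (sym eq₁) eq₁′))
                                     (up-injective δ u u′ (trans (sym eq₂) eq₂′))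

raised-noMin : ∀ {l} (u : Word n) {u′} → k < l → u′ ≡ up k 1 u → ¬ HasMin k (N (suc l) ∷ u′)
raised-noMin u k<l refl m = up-noMin 0 (N _ ∷ u) (subst (HasMin _) (sym (up-in k<l)) m)

Adj-injective : {u u′ v : Word n} → Adj k h u v → Adj k h u′ v → u ≡ u′
Adj-injective nil nil = refl
Adj-injective (zer A) (zer A′) = cong (_ ∷_) (Adj-injective A A′)
Adj-injective (exit _) (exit _) = refl
Adj-injective (exit l≤k) (raise k<l _ _) = contradiction (m≤n⇒m≤1+n k<l) (≤⇒≯ l≤k)
Adj-injective (exit l≤k) (lower _ k<l _ _ _ _) = contradiction k<l (≤⇒≯ l≤k)
Adj-injective (raise k<l _ _) (exit l≤k) = contradiction (m≤n⇒m≤1+n k<l) (≤⇒≯ l≤k)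
Adj-injective (raise _ _ eq) (raise _ _ eq′) = cong (_ ∷_) (up-injective 1 _ _ (trans (sym eq) eq′))
Adj-injective (raise {u = u} k<l _ eq) (lower _ _ _ _ _ m) = contradiction m (raised-noMin u k<l eq)
Adj-injective (lower _ k<l _ _ _ _) (exit l≤k) = contradiction k<l (≤⇒≯ l≤k)
Adj-injective (lower _ _ _ _ _ m) (raise {u = u} k<l _ eq) = contradiction m (raised-noMin u k<l eq)
Adj-injective (lower {l = l} δ _ refl eq₁ refl _) (lower ε _ refl eq₁′ refl _)
  with +-cancelʳ-≡ l δ ε (trans (sym eq₁) eq₁′)
... | refl = refl

-- The transformation of words.

-- Letters are treated from right to left: the tail is transformed first, then the segment of the
-- head is moved as a whole.
data Transform : ∀ {n} → Word n → Word n → Set where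
  nil : Transform [] []
  zer : {w u : Word n} → Transform w u → Transform (Z h ∷ w) (Z h ∷ u)
  nz  : {w u u′ : Word n} → Transform w u → Adj k k u u′ → Transform (N k ∷ w) (N k ∷ u′)

Transform-total : {w : Word n} → Valid h w → ∃[ u ] (Transform w u × Valid h u)
Transform-total [] = [] , nil , []
Transform-total (zer v) = let u , r , v′ = Transform-total v in Z _ ∷ u , zer r , zer v′
Transform-total (nz 2≤k k≤ v) =
  let u , r , v′ = Transform-total v
      u′ , A , v″ = adjust (<⇒≤ 2≤k) ≤-refl v′
  in N _ ∷ u′ , nz r A , nz 2≤k k≤ v″

Transform-onto : {u : Word n} → Valid h u → ∃[ w ] (Transform w u × Valid h w)
Transform-onto [] = [] , nil , []
Transform-onto (zer v) = let w , r , v′ = Transform-onto v in Z _ ∷ w , zer r , zer v′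
Transform-onto {n = suc n} (nz {w = u′} 2≤k k≤ v) = go (unadjust (<⇒≤ 2≤k) ≤-refl v)
  where
  go : ∃[ u ] (Adj _ _ u u′ × Valid _ u) → ∃[ w ] (Transform w (N _ ∷ u′) × Valid _ w)
  go (u , A , v′) = let w , r , v″ = Transform-onto v′ in N _ ∷ w , nz r A , nz 2≤k k≤ v″

Transform-functional : {w u u′ : Word n} → Transform w u → Transform w u′ → u ≡ u′
Transform-functional nil nil = refl
Transform-functional (zer r) (zer r′) = cong (_ ∷_) (Transform-functional r r′)
Transform-functional (nz r A) (nz r′ A′) with Transform-functional r r′
... | refl = cong (_ ∷_) (Adj-functional A A′)

Transform-injective : {w w′ u : Word n} → Transform w u → Transform w′ u → w ≡ w′
Transform-injective nil nil = refl
Transform-injective (zer r) (zer r′) = cong (_ ∷_) (Transform-injective r r′)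
Transform-injective (nz r A) (nz r′ A′) with Adj-injective A A′
... | refl = cong (_ ∷_) (Transform-injective r r′)

-- Statistics preserved by the transformation.

⇔-trans : {A B C : Set} → A ⇔ B → B ⇔ C → A ⇔ C
⇔-trans f g = mk⇔ (to g ∘ to f) (from f ∘ from g)

⇔-sym : {A B : Set} → A ⇔ B → B ⇔ A
⇔-sym f = mk⇔ (from f) (to f)

⇔-refl : {A : Set} → A ⇔ A
⇔-refl = mk⇔ (λ a → a) (λ a → a)

-- Inside the segment both sides of each comparison move by `δ`; the exit letter belongs to both
-- sets and makes them independent of `β`.
up-below : ∀ δ (w : Word n) → k ≤ suc β → below (δ + β) (up k δ w) ≡ below β w
up-below δ [] _ = refl
up-below δ (Z _ ∷ w) k≤ = cong (_ ∷_) (up-below δ w k≤)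
up-below {k = k} {β} δ (N l ∷ w) k≤ with l ≤? k
... | yes l≤k = trans (below-in (≤-trans l≤k (≤-trans k≤ (s≤s (m≤n+m β δ))))) (sym (below-in (≤-trans l≤k k≤)))
... | no l≰k with l ≤? suc β
...   | yes l≤ = trans (below-in (≤-trans (+-monoʳ-≤ δ l≤) (≤-reflexive (+-suc δ β))))
                   (cong (_ ∷_) (up-below δ w (m≤n⇒m≤1+n (<⇒≤ (≰⇒> l≰k)))))
...   | no l≰ = trans (below-out (≤-trans (≤-reflexive (cong suc (sym (+-suc δ β))))
                                  (≤-trans (≤-reflexive (sym (+-suc δ (suc β)))) (+-monoʳ-≤ δ (≰⇒> l≰)))))
                  (cong (_ ∷_) (up-below δ w k≤))

-- Letters with tails that look alike to all statistics of π.
data Sim {n} : Letter → Word n → Letter → Word n → Set where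
  simZ : ∀ {h h′ w w′} → below h w ≡ below h′ w′ → Sim (Z h) w (Z h′) w′
  simN : ∀ {k k′ w w′} → (k ≡ 2 ⇔ k′ ≡ 2) → below (pred k) w ≡ below (pred k′) w′ → below k w ≡ below k′ w′ →
         Sim (N k) w (N k′) w′

data AllSim : ∀ {n} → Word n → Word n → Set where
  []  : AllSim [] []
  _∷_ : ∀ {x x′} {w w′ : Word n} → Sim x w x′ w′ → AllSim w w′ → AllSim (x ∷ w) (x′ ∷ w′)

AllSim-refl : (w : Word n) → AllSim w w
AllSim-refl [] = []
AllSim-refl (Z _ ∷ w) = simZ refl ∷ AllSim-refl w
AllSim-refl (N _ ∷ w) = simN ⇔-refl refl refl ∷ AllSim-refl w

Sim-sym : ∀ {x x′} {w w′ : Word n} → Sim x w x′ w′ → Sim x′ w′ x w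
Sim-sym (simZ eq) = simZ (sym eq)
Sim-sym (simN two eq eq′) = simN (⇔-sym two) (sym eq) (sym eq′)

AllSim-sym : {w w′ : Word n} → AllSim w w′ → AllSim w′ w
AllSim-sym [] = []
AllSim-sym (s ∷ ss) = Sim-sym s ∷ AllSim-sym ss

up-Sim : ∀ δ {w : Word n} → 2 ≤ k → k ≤ h → Valid h w → AllSim w (up k δ w)
up-Sim δ _ _ [] = []
up-Sim δ {_ ∷ w} 2≤k k≤h (zer v) =
  simZ (sym (up-below δ w (m≤n⇒m≤1+n (m≤n⇒m≤1+n k≤h)))) ∷ up-Sim δ 2≤k (m≤n⇒m≤1+n k≤h) v
up-Sim {k = k} δ {N l ∷ w} 2≤k k≤h (nz _ _ v) with l ≤? k
... | yes _ = AllSim-refl _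
up-Sim {k = k} δ {N zero ∷ w} 2≤k k≤h (nz () _ v) | no _
up-Sim {k = k} δ {N (suc l) ∷ w} 2≤k k≤h (nz _ _ v) | no l≰k =
  -- Levels in the segment exceed `k`, which is at least 2, so level 2 occurs neither before nor
  -- after the shift.
  simN (mk⇔ (λ eq → contradiction (≤-trans (≤-reflexive eq) 2≤k) l≰k)
            (λ eq → contradiction (≤-trans (m≤n+m (suc l) δ) (≤-trans (≤-reflexive eq) 2≤k)) l≰k))
       (trans (sym (up-below δ w (<⇒≤ k<))) (cong (λ x → below (pred x) (up k δ w)) (sym (+-suc δ l))))
       (sym (up-below δ w (m≤n⇒m≤1+n (<⇒≤ k<))))
  ∷ up-Sim δ 2≤k (<⇒≤ k<) v
  where k< = ≰⇒> l≰k

Tail : Set₁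
Tail = ∀ {m} → Letter → Word m → Set

Invariant : Tail → Set
Invariant P = ∀ {m x x′} {w w′ : Word m} → Sim x w x′ w′ → P x w → P x′ w′

AllSim-At : {P : Tail} → Invariant P → {w w′ : Word n} → AllSim w w′ → ∀ i → At P w i ⇔ At P w′ i
AllSim-At inv (s ∷ ss) zero = mk⇔ (inv s) (inv (Sim-sym s))
AllSim-At {P = P} inv (s ∷ ss) (suc i) = AllSim-At {P = P} inv ss i

IsZ-invariant : Invariant IsZ
IsZ-invariant (simZ _) _ = tt

IsN2-invariant : Invariant IsN2
IsN2-invariant (simN two _ _) = to two

Vid-invariant : Invariant Vid
Vid-invariant (simN _ eq eq′) vid = trans (sym eq′) (trans vid eq)

Des-invariant : Invariant Des
Des-invariant (simZ eq) (j , z , m) = j , z , subst (j ∈_) eq m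
Des-invariant (simN _ eq _) (j , z , m) = j , z , subst (j ∈_) eq m

Rmi-invariant : Invariant Rmi
Rmi-invariant (simZ eq) f j m = f j (subst (j ∈_) (sym eq) m)
Rmi-invariant (simN _ eq _) f j m = f j (subst (j ∈_) (sym eq) m)

Adj-valid : {u u′ : Word n} → 1 ≤ k → k ≤ h → Adj k h u u′ → Valid h u → Valid h u′
Adj-valid 1≤k k≤h A v with adjust 1≤k k≤h v
... | _ , A′ , v′ with Adj-functional A A′
...   | refl = v′

Transform-valid : {w u : Word n} → Transform w u → Valid h w → Valid h u
Transform-valid r v with Transform-total v
... | _ , r′ , v′ with Transform-functional r r′
...   | refl = v′

Adj-Sim : ∀ {l l′} {u u′ : Word n} → 2 ≤ k → Adj k h (N l ∷ u) (N l′ ∷ u′) →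
          Valid h (N l ∷ u) → Valid h (N l′ ∷ u′) → AllSim (N l ∷ u) (N l′ ∷ u′)
Adj-Sim 2≤k (exit _) _ _ = AllSim-refl _
Adj-Sim 2≤k (raise {l = l} {u} k<l l≤h refl) (nz 2≤l _ v) _ =
  subst (AllSim (N l ∷ u)) (up-in k<l) (up-Sim 1 2≤k (≤-trans (<⇒≤ k<l) l≤h) (nz 2≤l (m≤n⇒m≤1+n l≤h) v))
Adj-Sim {k = k} 2≤k (lower {l = l} {u′ = u′} δ k<l _ refl refl _) _ (nz 2≤l _ v) =
  AllSim-sym (subst (AllSim (N l ∷ u′)) (up-in k<l) (up-Sim δ 2≤k (<⇒≤ k<l) (nz 2≤l (n≤1+n l) v)))

-- The leading letters Z keep their level while the tail moves, so similarity does not cover them;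
-- they are handled by `onZ`. From the first N on, `Adj-Sim` applies.
Adj-At : {P : Tail} → Invariant P → 2 ≤ k →
  (∀ {m h} {u u′ : Word m} → Adj k (suc h) u u′ → P (Z (suc h)) u ⇔ P (Z (suc h)) u′) →
  {u u′ : Word n} → Adj k h u u′ → Valid h u → Valid h u′ → ∀ i → At P u i ⇔ At P u′ i
Adj-At inv 2≤k onZ (zer A) _ _ zero = onZ A
Adj-At {P = P} inv 2≤k onZ (zer A) (zer v) (zer v′) (suc i) = Adj-At {P = P} inv 2≤k onZ A v v′ i
Adj-At {P = P} inv 2≤k onZ A@(exit _) v v′ = AllSim-At {P = P} inv (Adj-Sim 2≤k A v v′)
Adj-At {P = P} inv 2≤k onZ A@(raise _ _ _) v v′ = AllSim-At {P = P} inv (Adj-Sim 2≤k A v v′)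
Adj-At {P = P} inv 2≤k onZ A@(lower _ _ _ _ _ _) v v′ = AllSim-At {P = P} inv (Adj-Sim 2≤k A v v′)

Transform-At : {P : Tail} → Invariant P →
  (∀ {m k h} {u u′ : Word m} → Adj k (suc h) u u′ → P (Z (suc h)) u ⇔ P (Z (suc h)) u′) →
  (∀ {m k} {u u′ : Word m} → Adj k k u u′ → P (N k) u ⇔ P (N k) u′) →
  (∀ {m x} {w u : Word m} → Transform w u → P x w ⇔ P x u) →
  {w u : Word n} → Transform w u → Valid h w → ∀ i → At P w i ⇔ At P u i
Transform-At inv onZ onN onR (zer r) _ zero = onR r
Transform-At {P = P} inv onZ onN onR (zer r) (zer v) (suc i) = Transform-At {P = P} inv onZ onN onR r v i
Transform-At inv onZ onN onR (nz r A) _ zero = ⇔-trans (onR r) (onN A)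
Transform-At {P = P} inv onZ onN onR (nz r A) (nz 2≤k _ v) (suc i) =
  ⇔-trans (Transform-At {P = P} inv onZ onN onR r v i)
    (Adj-At {P = P} inv 2≤k onZ A (Transform-valid r v) (Adj-valid (<⇒≤ 2≤k) ≤-refl A (Transform-valid r v)) i)

Transform-IsZ : {w u : Word n} → Transform w u → Valid h w → ∀ i → At IsZ w i ⇔ At IsZ u i
Transform-IsZ = Transform-At {P = IsZ} IsZ-invariant (λ _ → ⇔-refl) (λ _ → ⇔-refl)
          λ { {x = Z _} _ → ⇔-refl ; {x = N _} _ → ⇔-refl }

Transform-IsN2 : {w u : Word n} → Transform w u → Valid h w → ∀ i → At IsN2 w i ⇔ At IsN2 u i
Transform-IsN2 = Transform-At {P = IsN2} IsN2-invariant (λ _ → ⇔-refl) (λ _ → ⇔-refl)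
           λ { {x = Z _} _ → ⇔-refl ; {x = N _} _ → ⇔-refl }

First : Subset n → Set
First p = ∃[ j ] (toℕ j ≡ 0 × j ∈ p)

First-outside : {p q : Subset n} → First (outside ∷ p) ⇔ First (outside ∷ q)
First-outside = mk⇔ (λ { (zero , _ , ()) ; (suc _ , () , _) }) (λ { (zero , _ , ()) ; (suc _ , () , _) })

First-N : ∀ {l} {w : Word n} → First (below β (N l ∷ w)) ⇔ l ≤ suc β
First-N = mk⇔ (λ { (zero , _ , m) → ∈below-head m ; (suc _ , () , _) }) (λ l≤ → zero , refl , head∈below l≤)

Transform-Des : {w u : Word n} → Transform w u → Valid h w → ∀ i → At Des w i ⇔ At Des u i
Transform-Des = Transform-At {P = Des} Des-invariant onZ onN (λ {_} {x} → onR x)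
  where
  onZ : ∀ {m k h} {u u′ : Word m} → Adj k (suc h) u u′ → First (below (suc h) u) ⇔ First (below (suc h) u′)
  onZ nil = ⇔-refl
  onZ (zer _) = First-outside
  onZ (exit _) = ⇔-refl
  -- Directly after a Z every N gives a descent, whatever its level.
  onZ (raise _ l≤h _) = mk⇔ (λ _ → from First-N (s≤s l≤h)) (λ _ → from First-N (m≤n⇒m≤1+n l≤h))
  onZ (lower {l = l} δ _ refl eq _ _) =
    mk⇔ (λ _ → from First-N (subst (l ≤_) (sym eq) (m≤n+m l δ))) (λ _ → from First-N ≤-refl)
  onN : ∀ {m k} {u u′ : Word m} → Adj k k u u′ → First (below (pred k) u) ⇔ First (below (pred k) u′)
  onN nil = ⇔-refl
  onN (zer _) = First-outside
  onN (exit _) = ⇔-refl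
  -- A letter of the segment directly after `N k` must have level `suc k`: it cannot be raised, and
  -- lowering leaves it in place.
  onN (raise k<l l≤k _) = contradiction l≤k (<⇒≱ k<l)
  onN (lower {l = l} δ k<l refl eq _ _) with ≤-antisym k<l (subst (l ≤_) (sym eq) (m≤n+m l δ))
  ... | refl = ⇔-trans First-N (⇔-sym First-N)
  onR : ∀ {m} x {w u : Word m} → Transform w u → First (below (base x) w) ⇔ First (below (base x) u)
  onR x nil = ⇔-refl
  onR x (zer _) = First-outside
  onR x (nz _ _) = ⇔-trans First-N (⇔-sym First-N)

-- DIST and VID.

-- For the word of e: the next nonzero entry equals the previous one.
NextMax : ℕ → Word n → Set
NextMax h [] = ⊥
NextMax h (Z _ ∷ w) = NextMax (suc h) w
NextMax h (N l ∷ w) = l ≡ suc h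

Dist : Letter → Word n → Set
Dist (Z _) _ = ⊥
Dist (N k) w = ¬ NextMax k w

Transform-NextMax : {w u : Word n} → Transform w u → ∀ {h} → NextMax h w ≡ NextMax h u
Transform-NextMax nil = refl
Transform-NextMax (zer r) = Transform-NextMax r
Transform-NextMax (nz _ _) = refl

-- The places `k` and `pred k` are told apart only by a letter of level `suc k`, which goes in
-- between; at the exit they merge.
noMin⇒below≡ : (w : Word n) → 1 ≤ k → ¬ HasMin k w → below k w ≡ below (pred k) w
noMin⇒below≡ [] _ _ = refl
noMin⇒below≡ (Z _ ∷ w) 1≤k ¬m = cong (_ ∷_) (noMin⇒below≡ w 1≤k (¬m ∘ overZ))
noMin⇒below≡ {k = suc k} (N l ∷ w) 1≤k ¬m with <-cmp l (suc (suc k))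
... | tri< (s≤s l≤k) _ _ = trans (below-in (m≤n⇒m≤1+n l≤k)) (sym (below-in l≤k))
... | tri≈ _ refl _ = contradiction here ¬m
... | tri> _ _ k<l = trans (below-out k<l)
    (trans (cong (_ ∷_) (noMin⇒below≡ w 1≤k (¬m ∘ overN (<-trans (n<1+n _) k<l))))
           (sym (below-out (<-trans (n<1+n _) k<l))))

HasMin⇒below≢ : {w : Word n} → 1 ≤ k → HasMin k w → below k w ≢ below (pred k) w
HasMin⇒below≢ {k = suc k} _ (here {w = w}) eq =
  contradiction (∈below-head (subst (zero ∈_) eq (head∈below {w = w} ≤-refl))) 1+n≰n
HasMin⇒below≢ 1≤k (overZ m) eq = HasMin⇒below≢ 1≤k m (∷-injectiveʳ eq)
HasMin⇒below≢ {k = suc k} 1≤k (overN {l = l} k<l m) eq with m≤n⇒m<n∨m≡n k<l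
... | inj₂ refl = HasMin⇒below≢ {k = suc k} 1≤k (here {w = _}) eq
... | inj₁ sk<l = HasMin⇒below≢ 1≤k m (∷-injectiveʳ (trans (sym (below-out sk<l)) (trans eq (below-out k<l))))

-- `NextMax` selects the segments that are lowered, and these are the ones whose image attains the
-- minimum.
Adj-Vid : {u u′ : Word n} → 1 ≤ k → k ≤ h → Adj k h u u′ → (¬ NextMax h u) ⇔ (below k u′ ≡ below (pred k) u′)
Adj-Vid _ _ nil = mk⇔ (λ _ → refl) (λ _ ())
Adj-Vid 1≤k k≤h (zer A) = ⇔-trans (Adj-Vid 1≤k (m≤n⇒m≤1+n k≤h) A) (mk⇔ (cong (_ ∷_)) ∷-injectiveʳ)
Adj-Vid {k = k} 1≤k k≤h (exit {l = l} {u} l≤k) =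
  mk⇔ (λ _ → noMin⇒below≡ (N l ∷ u) 1≤k λ { here → 1+n≰n l≤k ; (overN k<l _) → <⇒≱ k<l l≤k })
      (λ _ eq → <⇒≱ (≤-reflexive (sym eq)) (≤-trans l≤k k≤h))
Adj-Vid 1≤k k≤h (raise {l = l} {u} {u′} k<l l≤h eq) =
  mk⇔ (λ _ → noMin⇒below≡ (N (suc l) ∷ u′) 1≤k (raised-noMin u k<l eq))
      (λ _ eq′ → 1+n≰n (subst (_≤ _) eq′ l≤h))
Adj-Vid 1≤k k≤h (lower δ k<l eq _ _ m) =
  mk⇔ (λ ¬max → contradiction eq ¬max) (λ eq′ → contradiction eq′ (HasMin⇒below≢ 1≤k m))

Transform-Dist : {w u : Word n} → Transform w u → Valid h w → ∀ i → At Dist w i ⇔ At Vid u i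
Transform-Dist (zer r) _ zero = ⇔-refl
Transform-Dist (zer r) (zer v) (suc i) = Transform-Dist r v i
Transform-Dist (nz {k = k} {w} r A) (nz 2≤k _ v) zero =
  ⇔-trans (subst (λ X → (¬ NextMax k w) ⇔ (¬ X)) (Transform-NextMax r) ⇔-refl) (Adj-Vid (<⇒≤ 2≤k) ≤-refl A)
Transform-Dist (nz r A) (nz 2≤k _ v) (suc i) = ⇔-trans (Transform-Dist r v i)
  (Adj-At {P = Vid} Vid-invariant 2≤k (λ _ → ⇔-refl) A (Transform-valid r v)
    (Adj-valid (<⇒≤ 2≤k) ≤-refl A (Transform-valid r v)) i)

-- EXPO and RMI.

None : Subset n → Set
None p = ∀ j → j ∉ p

None-outside : {p : Subset n} → None (outside ∷ p) ⇔ None p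
None-outside = mk⇔ (λ f j m → f (suc j) (there m)) λ { f (suc j) (there m) → f j m }

-- A form of `None` that is visibly stable: shifting a segment of level `k ≥ c` keeps its levels
-- above `k`.
AllAbove : ℕ → Word n → Set
AllAbove c [] = ⊤
AllAbove c (Z _ ∷ w) = AllAbove c w
AllAbove c (N l ∷ w) = c < l × AllAbove c w

None⇔AllAbove : (w : Word n) → None (below β w) ⇔ AllAbove (suc β) w
None⇔AllAbove [] = mk⇔ (λ _ → tt) (λ _ ())
None⇔AllAbove (Z _ ∷ w) = ⇔-trans None-outside (None⇔AllAbove w)
None⇔AllAbove {β = β} (N l ∷ w) with l ≤? suc β
... | yes l≤ = mk⇔ (λ f → contradiction here (f zero)) (λ (<l , _) → contradiction l≤ (<⇒≱ <l))
... | no l≰ = mk⇔ (λ f → ≰⇒> l≰ , to (None⇔AllAbove w) (to None-outside f))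
                  (λ (_ , f) → from None-outside (from (None⇔AllAbove w) f))

AllAbove-up : ∀ {c} δ (w : Word n) → c ≤ k → AllAbove c w ⇔ AllAbove c (up k δ w)
AllAbove-up δ [] _ = ⇔-refl
AllAbove-up δ (Z _ ∷ w) c≤k = AllAbove-up δ w c≤k
AllAbove-up {k = k} δ (N l ∷ w) c≤k with l ≤? k
... | yes _ = ⇔-refl
... | no l≰k = mk⇔ (λ (_ , f) → ≤-trans (≤-<-trans c≤k (≰⇒> l≰k)) (m≤n+m l δ) , to (AllAbove-up δ w c≤k) f)
                   (λ (_ , f) → ≤-<-trans c≤k (≰⇒> l≰k) , from (AllAbove-up δ w c≤k) f)

AllAbove-Adj : ∀ {c} {u u′ : Word n} → c ≤ k → Adj k h u u′ → AllAbove c u ⇔ AllAbove c u′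
AllAbove-Adj c≤k nil = ⇔-refl
AllAbove-Adj c≤k (zer A) = AllAbove-Adj c≤k A
AllAbove-Adj c≤k (exit _) = ⇔-refl
AllAbove-Adj c≤k (raise {u = u} k<l _ refl) =
  mk⇔ (λ (_ , f) → m≤n⇒m≤1+n (≤-<-trans c≤k k<l) , to (AllAbove-up 1 u c≤k) f)
      (λ (_ , f) → ≤-<-trans c≤k k<l , from (AllAbove-up 1 u c≤k) f)
AllAbove-Adj c≤k (lower {l = l} {u′ = u′} δ k<l _ refl refl _) =
  mk⇔ (λ (_ , f) → ≤-<-trans c≤k k<l , from (AllAbove-up δ u′ c≤k) f)
      (λ (_ , f) → ≤-trans (≤-<-trans c≤k k<l) (m≤n+m l δ) , to (AllAbove-up δ u′ c≤k) f)

AllAbove-R : ∀ {c} {w u : Word n} → Transform w u → AllAbove c w ⇔ AllAbove c u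
AllAbove-R nil = ⇔-refl
AllAbove-R (zer r) = AllAbove-R r
AllAbove-R (nz r A) =
  mk⇔ (λ (lt , f) → lt , to (AllAbove-Adj (<⇒≤ lt) A) (to (AllAbove-R r) f))
      (λ (lt , f) → lt , from (AllAbove-R r) (from (AllAbove-Adj (<⇒≤ lt) A) f))

None-R : {w u : Word n} → Transform w u → None (below β w) ⇔ None (below β u)
None-R {w = w} {u} r = ⇔-trans (None⇔AllAbove w) (⇔-trans (AllAbove-R r) (⇔-sym (None⇔AllAbove u)))

HasMin-notAbove : ∀ {c} {w : Word n} → k < c → HasMin k w → ¬ AllAbove c w
HasMin-notAbove k<c here (lt , _) = <⇒≱ lt k<c
HasMin-notAbove k<c (overZ m) f = HasMin-notAbove k<c m f
HasMin-notAbove k<c (overN _ m) (_ , f) = HasMin-notAbove k<c m f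

-- A raise by one matches the step from `g` to `suc g`. A lowered segment fails on the left by
-- `NextMax` and on the right by its minimum; an exit letter lies in both sets.
Adj-Rmi : ∀ {g} {u u′ : Word n} → k ≤ g → g < h → Adj k h u u′ →
          ((¬ NextMax h u) × None (below g u)) ⇔ None (below (suc g) u′)
Adj-Rmi k≤g g<h nil = mk⇔ (λ _ ()) (λ _ → (λ ()) , λ ())
Adj-Rmi k≤g g<h (zer A) = mk⇔
  (λ (¬max , f) → from None-outside (to (Adj-Rmi k≤g (m≤n⇒m≤1+n g<h) A) (¬max , to None-outside f)))
  (λ f → let ¬max , f′ = from (Adj-Rmi k≤g (m≤n⇒m≤1+n g<h) A) (to None-outside f) in ¬max , from None-outside f′)
Adj-Rmi k≤g g<h (exit l≤k) = mk⇔
  (λ (_ , f) → contradiction (head∈below (≤-trans l≤k (m≤n⇒m≤1+n k≤g))) (f zero))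
  (λ f → contradiction (head∈below (≤-trans l≤k (m≤n⇒m≤1+n (m≤n⇒m≤1+n k≤g)))) (f zero))
Adj-Rmi {k = k} {g = g} k≤g g<h (raise {l = l} {u} k<l l≤h refl) = mk⇔
  (λ (_ , f) → subst None (sym eq) f)
  (λ f → (λ max → 1+n≰n (subst (_≤ _) max l≤h)) , subst None eq f)
  where
  eq : below (suc g) (N (suc l) ∷ up k 1 u) ≡ below g (N l ∷ u)
  eq = trans (cong (below (suc g)) (sym (up-in k<l))) (up-below 1 (N l ∷ u) (m≤n⇒m≤1+n k≤g))
Adj-Rmi k≤g g<h (lower δ k<l eq _ _ m) = mk⇔
  (λ (¬max , _) → contradiction eq ¬max)
  (λ f → contradiction (to (None⇔AllAbove _) f) (HasMin-notAbove (s≤s (m≤n⇒m≤1+n k≤g)) m))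

-- The Boolean records whether a letter N has occurred before.
Expo : Bool → Word n → Fin n → Set
Expo b (N k ∷ w) zero = None (below (pred k) w)
Expo b (N k ∷ w) (suc i) = Expo true w i
Expo b (Z h ∷ w) (suc i) = Expo b w i
Expo false (Z h ∷ w) zero = None (below h w)
Expo true (Z h ∷ w) zero = (¬ NextMax h w) × None (below (pred h) w)

Expo-N : ∀ k (w : Word n) i → Expo true (N k ∷ w) i ⇔ Expo false (N k ∷ w) i
Expo-N k w zero = ⇔-refl
Expo-N k w (suc i) = ⇔-refl

-- A letter N put in front switches the Boolean at the leading zeros and adjusts their tails;
-- `Adj-Rmi` matches both changes. From the next N on the Boolean has no effect.
Adj-Expo : {w u u′ : Word n} → 2 ≤ k → k ≤ h → Transform w u → Adj k h u u′ → Valid h u → Valid h u′ →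
           (∀ i → Expo false w i ⇔ At Rmi u i) → ∀ i → Expo true w i ⇔ At Rmi u′ i
Adj-Expo {h = h} 2≤k k≤h (zer {w = w} r) (zer A) _ _ ih zero = ⇔-trans
  (mk⇔ (λ (¬max , f) → subst ¬_ (Transform-NextMax r) ¬max , to (None-R r) f)
       (λ (¬max , f) → subst ¬_ (sym (Transform-NextMax r)) ¬max , from (None-R r) f))
  (Adj-Rmi k≤h ≤-refl A)
Adj-Expo 2≤k k≤h (zer r) (zer A) (zer v) (zer v′) ih (suc i) =
  Adj-Expo 2≤k (m≤n⇒m≤1+n k≤h) r A v v′ (ih ∘ suc) i
Adj-Expo 2≤k k≤h (nz {k = k} {w = w} _ _) A@(exit _) v v′ ih i =
  ⇔-trans (Expo-N k w i) (⇔-trans (ih i) (AllSim-At {P = Rmi} Rmi-invariant (Adj-Sim 2≤k A v v′) i))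
Adj-Expo 2≤k k≤h (nz {k = k} {w = w} _ _) A@(raise _ _ _) v v′ ih i =
  ⇔-trans (Expo-N k w i) (⇔-trans (ih i) (AllSim-At {P = Rmi} Rmi-invariant (Adj-Sim 2≤k A v v′) i))
Adj-Expo 2≤k k≤h (nz {k = k} {w = w} _ _) A@(lower _ _ _ _ _ _) v v′ ih i =
  ⇔-trans (Expo-N k w i) (⇔-trans (ih i) (AllSim-At {P = Rmi} Rmi-invariant (Adj-Sim 2≤k A v v′) i))

Transform-Expo : {w u : Word n} → Transform w u → Valid h w → ∀ i → Expo false w i ⇔ At Rmi u i
Transform-Expo (zer r) _ zero = None-R r
Transform-Expo (zer r) (zer v) (suc i) = Transform-Expo r v i
Transform-Expo (nz {k = zero} r A) (nz () _ _) zero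
Transform-Expo (nz {k = suc k} {u = u} {u′} r A) _ zero =
  ⇔-trans (None-R r) (⇔-trans (None⇔AllAbove u) (⇔-trans (AllAbove-Adj ≤-refl A) (⇔-sym (None⇔AllAbove u′))))
Transform-Expo (nz r A) (nz 2≤k _ v) (suc i) =
  Adj-Expo 2≤k ≤-refl r A (Transform-valid r v) (Adj-valid (<⇒≤ 2≤k) ≤-refl A (Transform-valid r v)) (Transform-Expo r v) i

-- Encoding of inversion sequences avoiding 021.

-- p is the number of entries already read; positions are counted from 0, hence v + k = p + 2.
data Enc : ∀ {n} → ℕ → ℕ → Vec ℕ n → Word n → Set where
  nil : Enc p h [] []
  zer : {e : Vec ℕ n} {w : Word n} → Enc (suc p) (suc h) e w → Enc p h (0 ∷ e) (Z (suc h) ∷ w)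
  nz  : ∀ {v} {e : Vec ℕ n} {w : Word n} → v + k ≡ suc (suc p) → 1 ≤ v → 2 ≤ k → k ≤ suc h →
        Enc (suc p) k e w → Enc p h (v ∷ e) (N k ∷ w)

Enc⇒Valid : {e : Vec ℕ n} {w : Word n} → Enc p h e w → Valid h w
Enc⇒Valid nil = []
Enc⇒Valid (zer E) = zer (Enc⇒Valid E)
Enc⇒Valid (nz _ _ 2≤k k≤ E) = nz 2≤k k≤ (Enc⇒Valid E)

Enc-functional : {e : Vec ℕ n} {w w′ : Word n} → Enc p h e w → Enc p h e w′ → w ≡ w′
Enc-functional nil nil = refl
Enc-functional (zer E) (zer E′) = cong (_ ∷_) (Enc-functional E E′)
Enc-functional (zer _) (nz _ () _ _ _)
Enc-functional (nz _ () _ _ _) (zer _)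
Enc-functional (nz {v = v} eq _ _ _ E) (nz eq′ _ _ _ E′) with +-cancelˡ-≡ v _ _ (trans eq (sym eq′))
... | refl = cong (_ ∷_) (Enc-functional E E′)

Enc-injective : {e e′ : Vec ℕ n} {w : Word n} → Enc p h e w → Enc p h e′ w → e ≡ e′
Enc-injective nil nil = refl
Enc-injective (zer E) (zer E′) = cong (_ ∷_) (Enc-injective E E′)
Enc-injective (nz {k = k} eq _ _ _ E) (nz eq′ _ _ _ E′) =
  cong₂ _∷_ (+-cancelʳ-≡ k _ _ (trans eq (sym eq′))) (Enc-injective E E′)

-- Translates the bound on levels into weak increase of the nonzero entries, with `m` a lower bound
-- such as the previous nonzero entry.
level-≤ : ∀ {v} → m + h ≡ suc p → v + k ≡ suc (suc p) → k ≤ suc h → m ≤ v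
level-≤ {m} {h} {p} {k} {v} eq eq′ k≤ = +-cancelʳ-≤ (suc h) m v
  (≤-trans (≤-reflexive (trans (+-suc m h) (trans (cong suc eq) (sym eq′)))) (+-monoʳ-≤ v k≤))

Enc-lower : {e : Vec ℕ n} {w : Word n} → Enc p h e w → m + h ≡ suc p → ∀ j → lookup e j ≡ 0 ⊎ m ≤ lookup e j
Enc-lower (zer E) eq zero = inj₁ refl
Enc-lower {h = h} {m = m} (zer E) eq (suc j) = Enc-lower E (trans (+-suc m h) (cong suc eq)) j
Enc-lower (nz eq′ _ _ k≤ E) eq zero = inj₂ (level-≤ eq eq′ k≤)
Enc-lower (nz eq′ _ _ k≤ E) eq (suc j) with Enc-lower E eq′ j
... | inj₁ z = inj₁ z
... | inj₂ v≤ = inj₂ (≤-trans (level-≤ eq eq′ k≤) v≤)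

Enc-bounded : {e : Vec ℕ n} {w : Word n} → Enc p h e w → ∀ j → lookup e j ≤ p + toℕ j
Enc-bounded (zer E) zero = z≤n
Enc-bounded {p = p} (nz {k = k} {v = v} eq _ 2≤k _ E) zero = subst (v ≤_) (sym (+-identityʳ p))
  (+-cancelʳ-≤ 2 v p (≤-trans (+-monoʳ-≤ v 2≤k) (≤-reflexive (trans eq (+-comm 2 p)))))
Enc-bounded {p = p} (zer {e = e} E) (suc j) = subst (lookup e j ≤_) (sym (+-suc p (toℕ j))) (Enc-bounded E j)
Enc-bounded {p = p} (nz {e = e} _ _ _ _ E) (suc j) =
  subst (lookup e j ≤_) (sym (+-suc p (toℕ j))) (Enc-bounded E j)

Enc-monotone : {e : Vec ℕ n} {w : Word n} → Enc p h e w → ∀ i j → i <ᶠ j → lookup e j ≡ 0 ⊎ lookup e i ≤ lookup e j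
Enc-monotone (zer E) zero (suc j) _ = inj₂ z≤n
Enc-monotone (nz eq _ _ _ E) zero (suc j) _ = Enc-lower E eq j
Enc-monotone (zer E) (suc i) (suc j) (s≤s i<j) = Enc-monotone E i j i<j
Enc-monotone (nz _ _ _ _ E) (suc i) (suc j) (s≤s i<j) = Enc-monotone E i j i<j

Enc⇒InI021 : {e : Vec ℕ n} {w : Word n} → Enc 0 0 e w → InI021 e
Enc⇒InI021 {e = e} E = (λ i → s≤s (Enc-bounded E i)) , avoids
  where
  avoids : Avoids021 e
  avoids i j k i<j j<k (i<πk , k<πj) with Enc-monotone E j k j<k
  ... | inj₁ z = contradiction (subst (lookup e i <_) z i<πk) λ ()
  ... | inj₂ le = <⇒≱ k<πj le

encode : (e : Vec ℕ n) → m + h ≡ suc p → (∀ j → lookup e j ≤ p + toℕ j) →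
         (∀ j → lookup e j ≡ 0 ⊎ m ≤ lookup e j) → (∀ i j → i <ᶠ j → lookup e j ≡ 0 ⊎ lookup e i ≤ lookup e j) →
         ∃[ w ] Enc p h e w
encode [] _ _ _ _ = [] , nil
encode {m = m} {h} {p} (zero ∷ e) eq bnd low mono =
  let w , E = encode e (trans (+-suc m h) (cong suc eq))
                (λ j → subst (lookup e j ≤_) (+-suc p (toℕ j)) (bnd (suc j)))
                (λ j → low (suc j)) (λ i j i<j → mono (suc i) (suc j) (s≤s i<j))
  in Z (suc h) ∷ w , zer E
encode {m = m} {h} {p} (suc v ∷ e) eq bnd low mono =
  let w , E = encode e v+l≡ (λ j → subst (lookup e j ≤_) (+-suc p (toℕ j)) (bnd (suc j)))
                (λ j → mono zero (suc j) (s≤s z≤n)) (λ i j i<j → mono (suc i) (suc j) (s≤s i<j))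
  in N l ∷ w , nz v+l≡ (s≤s z≤n) 2≤l l≤ E
  where
  v≤p : suc v ≤ p
  v≤p = subst (suc v ≤_) (+-identityʳ p) (bnd zero)
  l = suc (suc p) ∸ suc v
  v+l≡ : suc v + l ≡ suc (suc p)
  v+l≡ = m+[n∸m]≡n (≤-trans v≤p (≤-trans (n≤1+n p) (n≤1+n (suc p))))
  2≤l : 2 ≤ l
  2≤l = +-cancelˡ-≤ (suc v) 2 l (≤-trans (+-monoˡ-≤ 2 v≤p) (≤-reflexive (trans (+-comm p 2) (sym v+l≡))))
  m≤v : m ≤ suc v
  m≤v with low zero
  ... | inj₂ le = le
  l≤ : l ≤ suc h
  l≤ = +-cancelˡ-≤ (suc v) l (suc h) (≤-trans (≤-reflexive (trans v+l≡ (trans (cong suc (sym eq)) (sym (+-suc m h)))))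
                                               (+-monoˡ-≤ (suc h) m≤v))

InI021⇒Enc : {e : Vec ℕ n} → InI021 e → ∃[ w ] Enc 0 0 e w
-- Level 0 at the start corresponds to the lower bound 1 for nonzero entries.
InI021⇒Enc {e = e} (inv , av) = encode {m = 1} e refl (λ j → s≤s⁻¹ (inv j)) low (mono e inv av)
  where
  low : ∀ j → lookup e j ≡ 0 ⊎ 1 ≤ lookup e j
  low j with lookup e j
  ... | zero = inj₁ refl
  ... | suc _ = inj₂ (s≤s z≤n)
  mono : (e : Vec ℕ n) → IsInversionSeq e → Avoids021 e → ∀ i j → i <ᶠ j → lookup e j ≡ 0 ⊎ lookup e i ≤ lookup e j
  mono (x ∷ e) inv av zero j _ = inj₂ (≤-trans (s≤s⁻¹ (inv zero)) z≤n)
  mono (x ∷ e) inv av (suc i) (suc j) i<j with lookup e j in eq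
  ... | zero = inj₁ refl
  ... | suc v with lookup e i ≤? suc v
  ...   | yes le = inj₂ le
  -- The first entry is 0, so a decrease between nonzero entries would complete a 021.
  ...   | no nle = ⊥-elim (av zero (suc i) (suc j) (s≤s z≤n) i<j
            (subst (x <_) (sym eq) (≤-trans (inv zero) (s≤s z≤n)) , subst (_< lookup e i) (sym eq) (≰⇒> nle)))

decode : {w : Word n} → Valid h w → m + h ≡ suc p → 1 ≤ m → ∃[ e ] Enc p h e w
decode [] _ _ = [] , nil
decode {h = h} {m} (zer v) eq 1≤m =
  let e , E = decode v (trans (+-suc m h) (cong suc eq)) 1≤m in 0 ∷ e , zer E
decode {h = h} {m} {p} (nz {k = k} 2≤k k≤ v) eq 1≤m =
  let e , E = decode v v+k≡ 1≤v in suc (suc p) ∸ k ∷ e , nz v+k≡ 1≤v 2≤k k≤ E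
  where
  v+k≡ : suc (suc p) ∸ k + k ≡ suc (suc p)
  v+k≡ = m∸n+n≡m (≤-trans k≤ (s≤s (≤-trans (m≤n+m h m) (≤-reflexive eq))))
  1≤v = ≤-trans 1≤m (level-≤ eq v+k≡ k≤)

-- Statistics of the inversion sequence on its word.

Enc-ZERO : {e : Vec ℕ n} {w : Word n} → Enc p h e w → ∀ i → lookup e i ≡ 0 ⇔ At IsZ w i
Enc-ZERO (zer E) zero = mk⇔ (λ _ → tt) (λ _ → refl)
Enc-ZERO (nz _ (s≤s _) _ _ E) zero = mk⇔ (λ ()) (λ ())
Enc-ZERO (zer E) (suc i) = Enc-ZERO E i
Enc-ZERO (nz _ _ _ _ E) (suc i) = Enc-ZERO E i

-- Stated past the first position, where the entry 0 is maximal although its letter is a Z.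
Enc-EMA : {e : Vec ℕ n} {w : Word n} → Enc (suc p) h e w → ∀ i → lookup e i ≡ suc p + toℕ i ⇔ At IsN2 w i
Enc-EMA (zer E) zero = mk⇔ (λ ()) (λ ())
Enc-EMA {p = p} (nz {k = k} {v = v} eq _ _ _ E) zero rewrite +-identityʳ p =
  mk⇔ (λ { refl → +-cancelˡ-≡ (suc p) k 2 (trans eq (+-comm 2 (suc p))) })
      (λ { refl → +-cancelʳ-≡ 2 v (suc p) (trans eq (+-comm 2 (suc p))) })
Enc-EMA {p = p} (zer E) (suc i) rewrite +-suc p (toℕ i) = Enc-EMA E i
Enc-EMA {p = p} (nz _ _ _ _ E) (suc i) rewrite +-suc p (toℕ i) = Enc-EMA E i

EMA⇔ : {e : Vec ℕ n} {w : Word n} → Enc 0 0 e w → ∀ i → EMA e i ⇔ (toℕ i ≡ 0 ⊎ At IsN2 w i)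
EMA⇔ (zer E) zero = mk⇔ (λ _ → inj₁ refl) (λ _ → refl)
EMA⇔ (zer E) (suc i) = mk⇔ (inj₂ ∘ to (Enc-EMA E i)) λ { (inj₁ ()) ; (inj₂ a) → from (Enc-EMA E i) a }
EMA⇔ (nz _ _ 2≤k k≤1 _) _ = contradiction (≤-trans 2≤k k≤1) λ { (s≤s ()) }

FirstAbove : ℕ → Vec ℕ n → Set
FirstAbove v e = ∃[ j ] (toℕ j ≡ 0 × v < lookup e j)

ascent-Z : {e : Vec ℕ n} {w : Word n} → Enc p h e w → FirstAbove 0 e ⇔ First (below h w)
ascent-Z nil = mk⇔ (λ ()) (λ ())
ascent-Z (zer _) = mk⇔ (λ { (zero , _ , ()) ; (suc _ , () , _) }) (λ { (zero , _ , ()) ; (suc _ , () , _) })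
ascent-Z (nz _ 1≤v _ k≤ _) = mk⇔ (λ _ → from First-N k≤) (λ _ → zero , refl , 1≤v)

ascent-N : ∀ {v} {e : Vec ℕ n} {w : Word n} → v + k ≡ suc p → 2 ≤ k → Enc p k e w →
           FirstAbove v e ⇔ First (below (pred k) w)
ascent-N eq _ nil = mk⇔ (λ ()) (λ ())
ascent-N eq _ (zer _) = mk⇔ (λ { (zero , _ , ()) ; (suc _ , () , _) }) (λ { (zero , _ , ()) ; (suc _ , () , _) })
ascent-N {k = suc k} {v = v} eq _ (nz {k = l} {v = u} eq′ _ _ _ _) = mk⇔
  (λ { (zero , _ , v<u) → from First-N (+-cancelˡ-≤ u l (suc k)
         (≤-trans (≤-reflexive (trans eq′ (cong suc (sym eq)))) (+-monoˡ-≤ (suc k) v<u)))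
     ; (suc _ , () , _) })
  (λ f → zero , refl , +-cancelʳ-≤ (suc k) (suc v) u
         (≤-trans (≤-reflexive (trans (cong suc eq) (sym eq′))) (+-monoʳ-≤ u (to First-N f))))

Enc-ASC : {e : Vec ℕ n} {w : Word n} → Enc p h e w → ∀ i → ASC e i ⇔ At Des w i
Enc-ASC {e = x ∷ e} E zero = ⇔-trans step (first E)
  where
  step : ASC (x ∷ e) zero ⇔ FirstAbove x e
  step = mk⇔ (λ { (suc j , eq , lt) → j , suc-injective eq , lt }) (λ (j , eq , lt) → suc j , cong suc eq , lt)
  first : ∀ {w} → Enc _ _ (x ∷ e) w → FirstAbove x e ⇔ At Des w zero
  first (zer E) = ascent-Z E
  first (nz eq _ 2≤k _ E) = ascent-N eq 2≤k E
Enc-ASC {e = x ∷ e} E (suc i) = ⇔-trans step (rest E)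
  where
  step : ASC (x ∷ e) (suc i) ⇔ ASC e i
  step = mk⇔ (λ { (suc j , eq , lt) → j , suc-injective eq , lt }) (λ (j , eq , lt) → suc j , cong suc eq , lt)
  rest : ∀ {w} → Enc _ _ (x ∷ e) w → ASC e i ⇔ At Des w (suc i)
  rest (zer E) = Enc-ASC E i
  rest (nz _ _ _ _ E) = Enc-ASC E i

-- Nonzero entries increase weakly, so if `v` recurs, the next nonzero entry already equals it.
NextMax⇔ : ∀ {v} {e : Vec ℕ n} {w : Word n} → Enc p h e w → v + h ≡ suc p → 1 ≤ v →
           NextMax h w ⇔ (∃[ j ] v ≡ lookup e j)
NextMax⇔ nil _ _ = mk⇔ (λ ()) (λ ())
NextMax⇔ {h = h} {v = v} (zer E) eq 1≤v =
  mk⇔ (λ x → let j , eq′ = to rec x in suc j , eq′)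
      (λ { (zero , refl) → contradiction 1≤v λ () ; (suc j , eq′) → from rec (j , eq′) })
  where rec = NextMax⇔ E (trans (+-suc v h) (cong suc eq)) 1≤v
NextMax⇔ {p = p} {h} {v} {e = u ∷ e} (nz {k = k} eq′ _ _ k≤ E) eq 1≤v = mk⇔ forward backward
  where
  v+h : v + suc h ≡ suc (suc p)
  v+h = trans (+-suc v h) (cong suc eq)
  forward : k ≡ suc h → ∃[ j ] v ≡ lookup (u ∷ e) j
  forward refl = zero , +-cancelʳ-≡ (suc h) v u (trans v+h (sym eq′))
  same : v ≡ u → k ≡ suc h
  same refl = +-cancelˡ-≡ v k (suc h) (trans eq′ (sym v+h))
  backward : ∃[ j ] v ≡ lookup (u ∷ e) j → k ≡ suc h
  backward (zero , v≡u) = same v≡u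
  backward (suc j , v≡) with Enc-lower E eq′ j
  ... | inj₁ z = contradiction (trans v≡ z) (m<n⇒n≢0 1≤v)
  ... | inj₂ u≤ = same (≤-antisym (level-≤ eq eq′ k≤) (subst (u ≤_) (sym v≡) u≤))

LastOccurrence : Vec ℕ n → Fin n → Set
LastOccurrence e i = lookup e i ≢ 0 × (∀ j → i <ᶠ j → lookup e i ≢ lookup e j)

Enc-DIST : {e : Vec ℕ n} {w : Word n} → Enc p h e w → ∀ i → LastOccurrence e i ⇔ At Dist w i
Enc-DIST (zer E) zero = mk⇔ (λ (ne , _) → ne refl) (λ ())
Enc-DIST (nz eq 1≤v _ _ E) zero = mk⇔
  (λ (_ , f) max → let j , eq′ = to (NextMax⇔ E eq 1≤v) max in f (suc j) (s≤s z≤n) eq′)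
  (λ ¬max → m<n⇒n≢0 1≤v , λ { (suc j) _ eq′ → ¬max (from (NextMax⇔ E eq 1≤v) (j , eq′)) })
Enc-DIST {e = x ∷ e} E (suc i) = ⇔-trans step (rest E)
  where
  step : LastOccurrence (x ∷ e) (suc i) ⇔ LastOccurrence e i
  step = mk⇔ (λ (ne , f) → ne , λ j i<j → f (suc j) (s≤s i<j))
             (λ (ne , f) → ne , λ { (suc j) (s≤s i<j) → f j i<j })
  rest : ∀ {w} → Enc _ _ (x ∷ e) w → LastOccurrence e i ⇔ At Dist w (suc i)
  rest (zer E) = Enc-DIST E i
  rest (nz _ _ _ _ E) = Enc-DIST E i

DIST⇔ : {e : Vec ℕ n} {w : Word n} → Enc 0 0 e w → ∀ i → DIST e i ⇔ At Dist w i
DIST⇔ E i = mk⇔ (λ (_ , d) → to (Enc-DIST E i) d) (λ d → positive E i (proj₁ (from (Enc-DIST E i) d)) , from (Enc-DIST E i) d)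
  where
  positive : ∀ {n} {e : Vec ℕ n} {w} → Enc 0 0 e w → ∀ i → lookup e i ≢ 0 → 1 ≤ toℕ i
  positive (zer _) zero ne = contradiction refl ne
  positive (nz _ _ 2≤k k≤1 _) zero _ = contradiction (≤-trans 2≤k k≤1) λ { (s≤s ()) }
  positive _ (suc i) _ = s≤s z≤n

-- EXPO on words.

-- The quantity `i - d_i`; at a zero it depends on whether the running maximum is still 0.
height : Bool → Word n → Fin n → ℕ
height b (N k ∷ w) zero = pred k
height b (N k ∷ w) (suc i) = height true w i
height b (Z h ∷ w) (suc i) = height b w i
height false (Z h ∷ w) zero = h
height true (Z h ∷ w) zero = pred h

-- m is the maximum of the entries already read; before the first nonzero entry the level h counts as
-- if that maximum were 1.
Context : Bool → (m p h : ℕ) → Set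
Context false m p h = m ≡ 0 × h ≡ p
Context true m p h = 1 ≤ m × m + h ≡ suc p

context-Z : ∀ b → Context b m p h → Context b m (suc p) (suc h)
context-Z false (eq , eq′) = eq , cong suc eq′
context-Z {m = m} {h = h} true (1≤m , eq) = 1≤m , trans (+-suc m h) (cong suc eq)

context-≤ : ∀ b {v} → Context b m p h → v + k ≡ suc (suc p) → k ≤ suc h → m ≤ v
context-≤ false (refl , _) _ _ = z≤n
context-≤ true (_ , eq) eq′ k≤ = level-≤ eq eq′ k≤

dvalFrom : ℕ → Vec ℕ n → Fin n → ℕ
dvalFrom m e i with lookup e i
... | zero  = m ⊔ maxPrefix e i
... | suc v = suc v

dval≡dvalFrom : (e : Vec ℕ n) (i : Fin n) → dval e i ≡ dvalFrom 0 e i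
dval≡dvalFrom e i with lookup e i
... | zero  = refl
... | suc _ = refl

dvalFrom-∷ : ∀ {x} {e : Vec ℕ n} (i : Fin n) → dvalFrom m (x ∷ e) (suc i) ≡ dvalFrom (m ⊔ x) e i
dvalFrom-∷ {m = m} {x} {e} i with lookup e i
... | zero  = sym (⊔-assoc m x (maxPrefix e i))
... | suc _ = refl

Enc-height : ∀ b {e : Vec ℕ n} {w : Word n} → Context b m p h → Enc p h e w → ∀ i →
             suc (p + toℕ i) ∸ dvalFrom m e i ≡ height b w i
Enc-height {m = m} {p = p} false (refl , refl) (zer E) zero = cong suc (+-identityʳ p)
Enc-height {m = m} {p = p} {h} true (_ , eq) (zer E) zero rewrite +-identityʳ p | ⊔-identityʳ m | sym eq = m+n∸m≡n m h
Enc-height {p = p} b c (nz {k = suc k} {v = suc v} eq _ _ _ E) zero rewrite +-identityʳ p =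
  trans (cong (_∸ suc v) (sym (suc-injective (trans (sym (+-suc (suc v) k)) eq)))) (m+n∸m≡n (suc v) k)
Enc-height {m = m} {p = p} b {0 ∷ e} c (zer E) (suc i) = trans
  (cong₂ _∸_ (cong suc (+-suc p (toℕ i)))
    (trans (dvalFrom-∷ {m = m} {0} {e} i) (cong (λ x → dvalFrom x e i) (⊔-identityʳ m))))
  (Enc-height b (context-Z b c) E i)
Enc-height {m = m} {p = p} b {v ∷ e} c (nz eq 1≤v _ k≤ E) (suc i) = trans
  (cong₂ _∸_ (cong suc (+-suc p (toℕ i)))
    (trans (dvalFrom-∷ {m = m} {v} {e} i) (cong (λ x → dvalFrom x e i) (m≤n⇒m⊔n≡n (context-≤ b c eq k≤)))))
  (Enc-height true (1≤v , eq) E i)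

-- Until a letter N of level at most `suc c` occurs, every height exceeds `c`; such a letter
-- violates both sides.
Valid-height : ∀ b {c} {w : Word n} → Valid h w → (if b then c < h else c ≤ h) →
               None (below c w) ⇔ (∀ j → c < height b w j)
Valid-height b [] _ = mk⇔ (λ _ ()) (λ _ ())
Valid-height false {c} (zer v) c≤h = mk⇔
  (λ { f zero → s≤s c≤h ; f (suc j) → to (Valid-height false v (m≤n⇒m≤1+n c≤h)) (to None-outside f) j })
  (λ f → from None-outside (from (Valid-height false v (m≤n⇒m≤1+n c≤h)) (f ∘ suc)))
Valid-height true {c} (zer v) c<h = mk⇔
  (λ { f zero → c<h ; f (suc j) → to (Valid-height true v (m≤n⇒m≤1+n c<h)) (to None-outside f) j })
  (λ f → from None-outside (from (Valid-height true v (m≤n⇒m≤1+n c<h)) (f ∘ suc)))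
Valid-height b {c} (nz {k = k} _ _ v) _ with k ≤? suc c
... | yes k≤ = mk⇔ (λ f → contradiction here (f zero))
                   (λ f → contradiction (≤-trans (f zero) (pred-mono-≤ k≤)) 1+n≰n)
... | no k≰ = mk⇔
  (λ { f zero → <⇒≤pred (≰⇒> k≰) ; f (suc j) → to rec (to None-outside f) j })
  (λ f → from None-outside (from rec (f ∘ suc)))
  where rec = Valid-height true v (<-trans (n<1+n c) (≰⇒> k≰))

-- The set `Cset` on words: by weak increase, a zero lies between equal nonzero entries just when
-- its neighbouring nonzero entries agree.
Covered : Bool → Word n → Fin n → Set
Covered b (N k ∷ w) zero = ⊥
Covered b (N k ∷ w) (suc i) = Covered true w i
Covered b (Z h ∷ w) (suc i) = Covered b w i
Covered false (Z h ∷ w) zero = ⊥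
Covered true (Z h ∷ w) zero = NextMax h w

Exposed : Bool → Word n → Fin n → Set
Exposed b w i = ¬ Covered b w i × (∀ j → i <ᶠ j → height b w i < height b w j)

Exposed⇔Expo : ∀ b {w : Word n} → Valid h w → ∀ i → Exposed b w i ⇔ Expo b w i
Exposed⇔Expo false (zer v) zero = mk⇔
  (λ (_ , f) → from (Valid-height false v ≤-refl) λ j → f (suc j) (s≤s z≤n))
  (λ f → (λ ()) , λ { (suc j) _ → to (Valid-height false v ≤-refl) f j })
Exposed⇔Expo true (zer v) zero = mk⇔
  (λ (¬c , f) → ¬c , from (Valid-height true v ≤-refl) λ j → f (suc j) (s≤s z≤n))
  (λ (¬c , f) → ¬c , λ { (suc j) _ → to (Valid-height true v ≤-refl) f j })
Exposed⇔Expo b (nz {k = suc k} _ _ v) zero = mk⇔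
  (λ (_ , f) → from (Valid-height true v ≤-refl) λ j → f (suc j) (s≤s z≤n))
  (λ f → (λ ()) , λ { (suc j) _ → to (Valid-height true v ≤-refl) f j })
Exposed⇔Expo b (zer v) (suc i) = ⇔-trans
  (mk⇔ (λ (¬c , f) → ¬c , λ j i<j → f (suc j) (s≤s i<j)) (λ (¬c , f) → ¬c , λ { (suc j) (s≤s i<j) → f j i<j }))
  (Exposed⇔Expo b v i)
Exposed⇔Expo b (nz _ _ v) (suc i) = ⇔-trans
  (mk⇔ (λ (¬c , f) → ¬c , λ j i<j → f (suc j) (s≤s i<j)) (λ (¬c , f) → ¬c , λ { (suc j) (s≤s i<j) → f j i<j }))
  (Exposed⇔Expo true v i)

-- `Cset` generalised for recursion: `ρ` holds the values already read.
CsetFrom : (ℕ → Set) → Vec ℕ n → Fin n → Set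
CsetFrom ρ e i = lookup e i ≡ 0 × ∃[ b ] (i <ᶠ b × lookup e b ≢ 0 ×
  (ρ (lookup e b) ⊎ ∃[ a ] (a <ᶠ i × lookup e a ≡ lookup e b)))

CsetFrom-∷ : ∀ {ρ x} {e : Vec ℕ n} i → CsetFrom ρ (x ∷ e) (suc i) ⇔ CsetFrom (λ y → ρ y ⊎ x ≡ y) e i
CsetFrom-∷ {ρ = ρ} {x} {e} i = mk⇔ forward backward
  where
  forward : CsetFrom ρ (x ∷ e) (suc i) → CsetFrom (λ y → ρ y ⊎ x ≡ y) e i
  forward (z , suc b , s≤s i<b , ne , inj₁ r) = z , b , i<b , ne , inj₁ (inj₁ r)
  forward (z , suc b , s≤s i<b , ne , inj₂ (zero , _ , eq)) = z , b , i<b , ne , inj₁ (inj₂ eq)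
  forward (z , suc b , s≤s i<b , ne , inj₂ (suc a , s≤s a<i , eq)) = z , b , i<b , ne , inj₂ (a , a<i , eq)
  backward : CsetFrom (λ y → ρ y ⊎ x ≡ y) e i → CsetFrom ρ (x ∷ e) (suc i)
  backward (z , b , i<b , ne , inj₁ (inj₁ r)) = z , suc b , s≤s i<b , ne , inj₁ r
  backward (z , b , i<b , ne , inj₁ (inj₂ eq)) = z , suc b , s≤s i<b , ne , inj₂ (zero , s≤s z≤n , eq)
  backward (z , b , i<b , ne , inj₂ (a , a<i , eq)) = z , suc b , s≤s i<b , ne , inj₂ (suc a , s≤s a<i , eq)

-- After a letter N, values read are at most `m` and later nonzero ones at least `m`, so only `m`
-- can be the common value.
Enc-Cset : ∀ b {ρ : ℕ → Set} {e : Vec ℕ n} {w : Word n} → Context b m p h → (∀ {x} → ρ x → x ≤ m) →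
           (b ≡ true → ρ m) → Enc p h e w → ∀ i → CsetFrom ρ e i ⇔ Covered b w i
Enc-Cset false (refl , _) bnd hit (zer E) zero = mk⇔
  (λ { (_ , _ , _ , ne , inj₁ r) → ne (n≤0⇒n≡0 (bnd r)) ; (_ , _ , _ , _ , inj₂ (_ , () , _)) }) (λ ())
Enc-Cset {m = m} {p} {h} true {ρ} {_ ∷ e} {_ ∷ w} c@(1≤m , _) bnd hit (zer E) zero = mk⇔ forward
  (λ max → let j , eq = to (NextMax⇔ E m+h 1≤m) max in
     refl , suc j , s≤s z≤n , subst (_≢ 0) eq (m<n⇒n≢0 1≤m) , inj₁ (subst ρ eq (hit refl)))
  where
  m+h = proj₂ (context-Z {p = p} {h = h} true c)
  forward : CsetFrom ρ (0 ∷ e) zero → NextMax (suc h) w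
  forward (_ , suc b , _ , ne , inj₁ r) with Enc-lower E m+h b
  ... | inj₁ z = contradiction z ne
  ... | inj₂ m≤ = from (NextMax⇔ E m+h 1≤m) (b , ≤-antisym m≤ (bnd r))
  forward (_ , _ , _ , _ , inj₂ (_ , () , _))
Enc-Cset b c bnd hit (nz _ 1≤v _ _ _) zero = mk⇔ (λ (z , _) → contradiction z (m<n⇒n≢0 1≤v)) (λ ())
Enc-Cset b {ρ} c bnd hit (zer E) (suc i) = ⇔-trans (CsetFrom-∷ {ρ = ρ} i)
  (Enc-Cset b {λ y → ρ y ⊎ 0 ≡ y} (context-Z b c) (λ { (inj₁ r) → bnd r ; (inj₂ refl) → z≤n }) (inj₁ ∘ hit) E i)
Enc-Cset b {ρ} c bnd hit (nz {v = v} eq 1≤v _ k≤ E) (suc i) = ⇔-trans (CsetFrom-∷ {ρ = ρ} i)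
  (Enc-Cset true {λ y → ρ y ⊎ v ≡ y} (1≤v , eq) (λ { (inj₁ r) → ≤-trans (bnd r) (context-≤ b c eq k≤) ; (inj₂ refl) → ≤-refl })
    (λ _ → inj₂ refl) E i)

EXPO⇔ : {e : Vec ℕ n} {w : Word n} → Enc 0 0 e w → ∀ i → EXPO e i ⇔ Expo false w i
EXPO⇔ {e = e} {w} E i = ⇔-trans
  (mk⇔ (λ (¬c , f) → (λ c → ¬c (uncover c)) , λ j i<j → subst₂ _<_ (eq i) (eq j) (f j i<j))
       (λ (¬c , f) → (λ c → ¬c (cover c)) , λ j i<j → subst₂ _<_ (sym (eq i)) (sym (eq j)) (f j i<j)))
  (Exposed⇔Expo false (Enc⇒Valid E) i)
  where
  eq : ∀ i → suc (toℕ i) ∸ dval e i ≡ height false w i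
  eq i = trans (cong (suc (toℕ i) ∸_) (dval≡dvalFrom e i)) (Enc-height false (refl , refl) E i)
  covered : CsetFrom (λ _ → ⊥) e i ⇔ Covered false w i
  covered = Enc-Cset false {ρ = λ _ → ⊥} (refl , refl) (λ ()) (λ ()) E i
  cover : Cset e i → Covered false w i
  cover (z , a , b , a<i , i<b , eq , ne) = to covered (z , b , i<b , subst (_≢ 0) eq ne , inj₂ (a , a<i , eq))
  uncover : Covered false w i → Cset e i
  uncover c with from covered c
  ... | z , b , i<b , ne , inj₂ (a , a<i , eq) = z , a , b , a<i , i<b , eq , subst (_≢ 0) (sym eq) ne

-- RMI of sequences and RMA of permutations.

next : {i j : Fin n} → i <ᶠ j → ∃[ l ] (toℕ l ≡ suc (toℕ i))
next {n = n} {i} {j} i<j = fromℕ< i+1<n , toℕ-fromℕ< i+1<n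
  where
  i+1<n : suc (toℕ i) < n
  i+1<n = ≤-<-trans i<j (toℕ<n j)

-- Without later zeros the entries after `i` increase weakly, so the first step decides. The second
-- condition asks for an ascent at `i` unless `i` is the last position.
RMIe⇔ : {e : Vec ℕ n} {w : Word n} → Enc 0 0 e w → ∀ i →
        RMIe e i ⇔ ((∀ j → i <ᶠ j → ¬ ZERO e j) × (∀ j → i <ᶠ j → ASC e i))
RMIe⇔ {e = e} E i = mk⇔
  (λ f → (λ j i<j → m<n⇒n≢0 (f j i<j)) ,
         (λ j i<j → let l , eq = next i<j in l , eq , f l (≤-reflexive (sym eq))))
  (λ (ne , asc) j i<j → backward ne j i<j (asc j i<j))
  where
  backward : (∀ j → i <ᶠ j → ¬ ZERO e j) → ∀ j → i <ᶠ j → ASC e i → lookup e i < lookup e j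
  backward ne j i<j (l , eq , lt) with m≤n⇒m<n∨m≡n i<j
  ... | inj₂ eq′ = subst (λ x → lookup e i < lookup e x) (toℕ-injective (trans eq eq′)) lt
  ... | inj₁ i+1<j with Enc-monotone E l j (subst (_< toℕ j) (sym eq) i+1<j)
  ...   | inj₁ z = contradiction z (ne j i<j)
  ...   | inj₂ le = <-≤-trans lt le

-- Strong induction on `j`, with bound `f`: a later value that is not a left-to-right maximum has a
-- larger one at some `l` before it, and the position of `l` relative to `i` decides.
RMA⇔ : {w : Word n} → Valid 0 w → ∀ i →
       RMA (perm w) i ⇔ ((∀ j → i <ᶠ j → ¬ LMA (perm w) j) × (∀ j → i <ᶠ j → DES (perm w) i))
RMA⇔ {n = n} {w} V i = mk⇔
  (λ f → (λ j i<j lma → <-asym (f j i<j) (lma i i<j)) ,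
         (λ j i<j → let l , eq = next i<j in l , eq , f l (≤-reflexive (sym eq))))
  (λ (nl , des) j i<j → backward nl (des j i<j) (suc (toℕ j)) j ≤-refl i<j)
  where
  backward : (∀ j → i <ᶠ j → ¬ LMA (perm w) j) → DES (perm w) i →
             ∀ f j → toℕ j < f → i <ᶠ j → lookup (perm w) j < lookup (perm w) i
  backward nl d@(c , eq , lt) (suc f) j (s≤s j≤f) i<j
    with cmp (perm w) (perm-avoids V) i<j
  ... | inj₁ ok = ok
  ... | inj₂ gt with isZ? w j
  ...   | inj₁ z = contradiction (from (LMA⇔ V j) z) (nl j i<j)
  ...   | inj₂ a with N-inverted₀ V j a
  ...     | l , inv with <ᶠ-cmp l i
  ...       | tri≈ _ refl _ = Inv⇒> V inv
  ...       | tri> _ _ i<l = <-trans (Inv⇒> V inv) (backward nl d f l (≤-trans (Inv⇒< w inv) j≤f) i<l)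
  -- The positions `l`, `i`, `c`, `j` would form a 4213.
  ...       | tri< l<i _ _ = ⊥-elim (no-split (perm w) (perm-avoids V) (<-trans l<i i<c) i<c c<j lt gt (Inv⇒> V inv))
    where
    i<c : i <ᶠ c
    i<c = ≤-reflexive (sym eq)
    c<j : c <ᶠ j
    c<j = ≤∧≢⇒< (subst (_≤ toℕ j) (sym eq) i<j)
            λ c≡j → <-asym gt (subst (λ x → lookup (perm w) x < lookup (perm w) i) (toℕ-injective c≡j) lt)

-- The bijection.

inI021? : (e : Vec ℕ n) → Dec (InI021 e)
inI021? e = all? (λ i → lookup e i <? suc (toℕ i)) ×-dec
  all? λ i → all? λ j → all? λ k → (i <ᶠ? j) →-dec ((j <ᶠ? k) →-dec
    ¬? ((lookup e i <? lookup e k) ×-dec (lookup e k <? lookup e j)))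

-- The map is handled through its graph, so that its properties do not depend on the witnesses
-- chosen by `related`.
Related : Vec ℕ n → Vec ℕ n → Set
Related e π = ∃[ w ] ∃[ u ] (Enc 0 0 e w × Transform w u × π ≡ perm u)

related : (e : Vec ℕ n) → InI021 e → ∃[ π ] Related e π
related e I = let w , E = InI021⇒Enc {e = e} I
                  u , r , _ = Transform-total (Enc⇒Valid E)
              in perm u , w , u , E , r , refl

Related-functional : {e π π′ : Vec ℕ n} → Related e π → Related e π′ → π ≡ π′
Related-functional (_ , _ , E , r , refl) (_ , _ , E′ , r′ , refl) with Enc-functional E E′
... | refl = cong perm (Transform-functional r r′)

Related-injective : {e e′ π : Vec ℕ n} → Related e π → Related e′ π → e ≡ e′
Related-injective (_ , _ , E , r , eq) (_ , _ , E′ , r′ , eq′)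
  with perm-injective (Transform-valid r (Enc⇒Valid E)) (Transform-valid r′ (Enc⇒Valid E′)) (trans (sym eq) eq′)
... | refl with Transform-injective r r′
...   | refl = Enc-injective E E′

Related-avoids : {e π : Vec ℕ n} → Related e π → InS2413-4213 π
Related-avoids (_ , _ , E , r , refl) = perm-avoids (Transform-valid r (Enc⇒Valid E))

Related-onto : (π : Vec ℕ n) → InS2413-4213 π → ∃[ e ] (InI021 e × Related e π)
Related-onto π P = let u , V , eq = perm-onto π P
                       w , r , V′ = Transform-onto V
                       e , E = decode {m = 1} {p = 0} V′ refl ≤-refl
                   in e , Enc⇒InI021 E , w , u , E , r , sym eq

⇔⇒≐ : {P Q : Stat n} → (∀ i → P i ⇔ Q i) → P ≐ Q
⇔⇒≐ f = (λ {i} → to (f i)) , (λ {i} → from (f i))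

Related-stats : {e π : Vec ℕ n} → Related e π →
  (DIST e ≐ VID π) × (ASC e ≐ DES π) × (ZERO e ≐ LMA π) ×
  (EMA e ≐ LMI π) × (RMIe e ≐ RMA π) × (EXPO e ≐ RMIπ π)
Related-stats {e = e} (w , u , E , r , refl) =
  ⇔⇒≐ (λ i → ⇔-trans (DIST⇔ E i) (⇔-trans (Transform-Dist r V i) (⇔-sym (VID⇔ U i)))) ,
  ⇔⇒≐ asc ,
  ⇔⇒≐ zero⇔ ,
  ⇔⇒≐ (λ i → ⇔-trans (EMA⇔ E i) (⇔-trans (two i) (⇔-sym (LMI⇔ U i)))) ,
  ⇔⇒≐ (λ i → ⇔-trans (RMIe⇔ E i) (⇔-trans (rmi i) (⇔-sym (RMA⇔ U i)))) ,
  ⇔⇒≐ (λ i → ⇔-trans (EXPO⇔ E i) (⇔-trans (Transform-Expo r V i) (⇔-sym (RMI⇔ U i))))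
  where
  V = Enc⇒Valid E
  U = Transform-valid r V
  asc : ∀ i → ASC e i ⇔ DES (perm u) i
  asc i = ⇔-trans (Enc-ASC E i) (⇔-trans (Transform-Des r V i) (⇔-sym (DES⇔ U i)))
  zero⇔ : ∀ i → ZERO e i ⇔ LMA (perm u) i
  zero⇔ i = ⇔-trans (Enc-ZERO E i) (⇔-trans (Transform-IsZ r V i) (⇔-sym (LMA⇔ U i)))
  two : ∀ i → (toℕ i ≡ 0 ⊎ At IsN2 w i) ⇔ (toℕ i ≡ 0 ⊎ At IsN2 u i)
  two i = mk⇔ (λ { (inj₁ z) → inj₁ z ; (inj₂ a) → inj₂ (to (Transform-IsN2 r V i) a) })
              (λ { (inj₁ z) → inj₁ z ; (inj₂ a) → inj₂ (from (Transform-IsN2 r V i) a) })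
  rmi : ∀ i → ((∀ j → i <ᶠ j → ¬ ZERO e j) × (∀ j → i <ᶠ j → ASC e i)) ⇔
              ((∀ j → i <ᶠ j → ¬ LMA (perm u) j) × (∀ j → i <ᶠ j → DES (perm u) i))
  rmi i = mk⇔ (λ (f , g) → (λ j i<j → f j i<j ∘ from (zero⇔ j)) , λ j i<j → to (asc i) (g j i<j))
              (λ (f , g) → (λ j i<j → f j i<j ∘ to (zero⇔ j)) , λ j i<j → from (asc i) (g j i<j))

bijection : Vec ℕ n → Vec ℕ n
bijection e with inI021? e
... | yes I = proj₁ (related e I)
-- Default value outside the class.
... | no _  = e

bijection-related : (e : Vec ℕ n) → InI021 e → Related e (bijection e)
bijection-related e I with inI021? e
... | yes I′ = proj₂ (related e I′)
... | no ¬I = contradiction I ¬I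

theorem3p5 : (n : ℕ) → 1 ≤ n →
    Σ[ Ψ ∈ (Vec ℕ n → Vec ℕ n) ] (
    (∀ (e : Vec ℕ n) → InI021 e → InS2413-4213 (Ψ e)) ×
    (∀ (e e′ : Vec ℕ n) → InI021 e → InI021 e′ → Ψ e ≡ Ψ e′ → e ≡ e′) ×
    (∀ (π : Vec ℕ n) → InS2413-4213 π → ∃[ e ] (InI021 e × Ψ e ≡ π)) ×
    (∀ (e : Vec ℕ n) → InI021 e →
    (DIST e ≐ VID (Ψ e)) × (ASC e ≐ DES (Ψ e)) × (ZERO e ≐ LMA (Ψ e)) ×
    (EMA e ≐ LMI (Ψ e)) × (RMIe e ≐ RMA (Ψ e)) × (EXPO e ≐ RMIπ (Ψ e))))
theorem3p5 n _ = bijection ,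
  (λ e I → Related-avoids (bijection-related e I)) ,
  (λ e e′ I I′ eq → Related-injective (bijection-related e I) (subst (Related e′) (sym eq) (bijection-related e′ I′))) ,
  (λ π P → let e , I , rel = Related-onto π P in e , I , Related-functional (bijection-related e I) rel) ,
  (λ e I → Related-stats (bijection-related e I))
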